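{- The star graph $X_3=\mathrm{Cay}(\mathfrak S_4,\{(1,4),(2,4),(3,4)\})$ is an $\mathfrak S_3$-cover of the complete graph $K_4$, whose intermediate covers are isomorphic to the cube graph or the truncated tetrahedron graph.
   Context: $\mathfrak S_m$ is the symmetric group on $\{1,\dots,m\}$; permutations are composed as functions, $(\xi\tau)(j)=\xi(\tau(j))$. The Cayley graph $\mathrm{Cay}(G,S)$ (with $S=S^{ -1}$, $1\notin S$) is the simple undirected graph with vertex set $G$ in which $\xi$ and $\eta$ are adjacent iff $\eta=\xi s$ for some $s\in S$. Cover: for finite simple graphs $\tilde X$ and $X$, a covering map $p:\tilde X\to X$ is a surjective graph morphism such that for every vertex $\tilde v$ of $\tilde X$, $p$ induces a bijection from the set of edges incident to $\tilde v$ to the set of edges incident to $p(\tilde v)$; $\tilde X$ is then a cover of $X$. Galois cover: a cover $p:\tilde X\to X$ is Galois if there is a group $G$ acting on $\tilde X$ (by graph automorphisms) that acts freely and transitively on each fiber $p^{ -1}(w)$, $w\in V(X)$, and such that the quotient graph $\tilde X/G$ is isomorphic to $X$. Then $G$ is called the Galois group and $\tilde X$ is called a $G$-cover of $X$. The quotient graph has the $G$-orbits of vertices as vertices, two orbits being adjacent iff some representatives are adjacent. Intermediate cover: given a covering map $p:\tilde X\to X$, an intermediate cover is a graph $Y$ together with covering maps $q:\tilde X\to Y$ and $r:Y\to X$ such that $p=r\circ q$. Here the covering map $p:X_3\to K_4$ is given on vertices by $p(\xi)=\xi(4)$, where $V(K_4)=\{1,2,3,4\}$, and $\mathfrak S_3$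 is identified with the subgroup of $\mathfrak S_4$ fixing $4$, acting on $V(X_3)=\mathfrak S_4$ by right multiplication. The cube graph is the 1-skeleton of the 3-dimensional cube (8 vertices, 3-regular). The truncated tetrahedron graph is the 1-skeleton of the truncated tetrahedron (12 vertices, 3-regular).
   Formalization: "Intermediate covers" is read as proper ones: neither X̃ → Y nor Y → X is an isomorphism, since X₃ and K₄ themselves are intermediate covers but are neither the cube graph nor the truncated tetrahedron graph. -}

module Defs where

open import Algebra.Bundles using (Group)
open import Data.Bool.Base using (Bool)
open import Data.Fin.Base
  using (Fin; zero; suc; fromℕ; inject₁; punchIn; combine; remQuot)
open import Data.Fin.Permutation as Perm
  using (Permutation′; _⟨$⟩ʳ_; _⟨$⟩ˡ_; _∘ₚ_; transpose; insert; remove)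
open import Data.Fin.Properties
  using (_≟_; fromℕ≢inject₁; inject₁-injective; punchIn-injective; combine-remQuot; remQuot-combine)
open import Data.Fin.Relation.Unary.Top using (view; ‵fromℕ; ‵inject₁)
open import Data.Nat.Base using (ℕ; zero; suc; _!)
open import Data.Product.Base
  using (Σ-syntax; ∃; ∃-syntax; _×_; _,_; proj₁; proj₂)
open import Data.Product using (∃!)
open import Data.Sum.Base as Sum using (_⊎_; inj₁; inj₂)
open import Data.Vec.Base using (Vec; lookup)
open import Function.Base using (_on_)
open import Function.Bundles using (Inverse; Injection)
open import Function.Construct.Identity using (inverse)
open import Function.Definitions using (Bijective; Surjective)
open import Function.Properties.Inverse using (↔⇒↣)
open import Level using (0ℓ)
open import Relation.Binary.Bundles using (Setoid)
import Relation.Binary.Construct.On as On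
open import Relation.Binary.Core using (Rel)
open import Relation.Binary.Definitions using (_Respects_; _Respects₂_; Symmetric; Irreflexive)
open import Relation.Binary.PropositionalEquality
  using (_≡_; _≢_; refl; sym; trans; cong; cong₂; setoid; module ≡-Reasoning)
import Relation.Binary.Reasoning.Setoid as SetoidReasoning
open import Relation.Nullary using (Dec; ¬_; yes; no; contradiction)
open import Relation.Nullary.Decidable using (dec-true; dec-false)
open import Relation.Unary using (Pred)

------------------------------------------------------------------------
-- Graphs

-- Vertices form a setoid, so that permutations (which are only
-- extensionally equal) and orbits can serve as vertices.  Loops are
-- allowed here only so that every quotient is again a graph.

record Graph : Set₁ where
  field
    vertices : Setoid 0ℓ 0ℓ

  open Setoid vertices public renaming
    (Carrier to Vertex; refl to ≈-refl; sym to ≈-sym; trans to ≈-trans)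

  field
    Adj        : Rel Vertex 0ℓ
    Adj-resp-≈ : Adj Respects₂ _≈_
    Adj-sym    : Symmetric Adj

IsFinite : Setoid 0ℓ 0ℓ → Set
IsFinite S = ∃[ n ] Inverse S (setoid (Fin n))

record IsFiniteSimple (X : Graph) : Set where
  open Graph X
  field
    irreflexive : Irreflexive _≈_ Adj
    finite      : IsFinite vertices

record FiniteSimpleGraph : Set₁ where
  field
    graph          : Graph
    isFiniteSimple : IsFiniteSimple graph

  open Graph graph public
  open IsFiniteSimple isFiniteSimple public

open FiniteSimpleGraph using (graph)

infix 4 _⟶_

record _⟶_ (X Y : Graph) : Set where
  private
    module X = Graph X
    module Y = Graph Y
  field
    to       : X.Vertex → Y.Vertex
    to-cong  : ∀ {u v} → u X.≈ v → to u Y.≈ to v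
    to-Adj   : ∀ {u v} → X.Adj u v → Y.Adj (to u) (to v)

open _⟶_ using (to)

record IsIsomorphism {X Y : Graph} (f : X ⟶ Y) : Set where
  private
    module X = Graph X
    module Y = Graph Y
  field
    bijective   : Bijective X._≈_ Y._≈_ (to f)
    reflectsAdj : ∀ {u v} → Y.Adj (to f u) (to f v) → X.Adj u v

infix 4 _≅_

_≅_ : Graph → Graph → Set
X ≅ Y = Σ[ f ∈ (X ⟶ Y) ] IsIsomorphism f

------------------------------------------------------------------------
-- Edges and covers

module _ (X : Graph) where
  open Graph X

  record Edge : Set where
    constructor edge
    field
      source target : Vertex
      adjacent      : Adj source target

  -- Edges are unordered pairs: equality forgets the orientation (and the
  -- proof of adjacency).
  _≈ᴱ_ : Rel Edge 0ℓ
  edge s t _ ≈ᴱ edge s′ t′ _ = (s ≈ s′ × t ≈ t′) ⊎ (s ≈ t′ × t ≈ s′)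

  Incident : Vertex → Edge → Set
  Incident v (edge s t _) = v ≈ s ⊎ v ≈ t

  EdgeAt : Vertex → Set
  EdgeAt v = ∃ (Incident v)

mapEdgeAt : {X Y : Graph} (f : X ⟶ Y) (v : Graph.Vertex X) →
            EdgeAt X v → EdgeAt Y (to f v)
mapEdgeAt f v (edge s t s~t , v∈e) =
  edge (to f s) (to f t) (to-Adj s~t) , Sum.map to-cong to-cong v∈e
  where open _⟶_ f using (to-cong; to-Adj)

record IsCovering (X̃ X : FiniteSimpleGraph) (p : graph X̃ ⟶ graph X) : Set where
  private
    module X̃ = FiniteSimpleGraph X̃
    module X = FiniteSimpleGraph X
  field
    surjective : Surjective X̃._≈_ X._≈_ (to p)
    bijective  : ∀ ṽ → Bijective (_≈ᴱ_ X̃.graph on proj₁) (_≈ᴱ_ X.graph on proj₁)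
                         (mapEdgeAt p ṽ)

record IntermediateCover (X̃ X : FiniteSimpleGraph) (p : graph X̃ ⟶ graph X) : Set₁ where
  field
    Y          : FiniteSimpleGraph
    q          : graph X̃ ⟶ graph Y
    r          : graph Y ⟶ graph X
    q-covering : IsCovering X̃ Y q
    r-covering : IsCovering Y X r
    factors    : ∀ ṽ → FiniteSimpleGraph._≈_ X (to p ṽ) (to r (to q ṽ))

  Proper : Set
  Proper = ¬ IsIsomorphism q × ¬ IsIsomorphism r

------------------------------------------------------------------------
-- Group actions and Galois covers

-- Each element acts by an automorphism: the inverse of v ↦ v · g is
-- v ↦ v · g ⁻¹, which preserves adjacency too.

record RightAction (G : Group 0ℓ 0ℓ) (X : Graph) : Set where
  private
    module G = Group G
    module X = Graph X
  infixl 7 _·_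
  field
    _·_        : X.Vertex → G.Carrier → X.Vertex
    ·-cong     : ∀ {u v g h} → u X.≈ v → g G.≈ h → u · g X.≈ v · h
    ·-identity : ∀ v → v · G.ε X.≈ v
    ·-assoc    : ∀ v g h → v · (g G.∙ h) X.≈ v · g · h
    ·-Adj      : ∀ {u v} g → X.Adj u v → X.Adj (u · g) (v · g)

module _ {G : Group 0ℓ 0ℓ} {X : Graph} (α : RightAction G X) where
  private
    module G = Group G
    module X = Graph X
  open RightAction α

  orbits : Setoid 0ℓ 0ℓ
  orbits = record
    { Carrier       = X.Vertex
    ; _≈_           = λ u v → ∃[ g ] u · g X.≈ v
    ; isEquivalence = record
      { refl  = G.ε , ·-identity _
      ; sym   = λ {u} {v} (g , ug≈v) → g G.⁻¹ , (begin
          v · g G.⁻¹           ≈⟨ ·-cong ug≈v G.refl ⟨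
          u · g · g G.⁻¹       ≈⟨ ·-assoc u g (g G.⁻¹) ⟨
          u · (g G.∙ g G.⁻¹)   ≈⟨ ·-cong X.≈-refl (G.inverseʳ g) ⟩
          u · G.ε              ≈⟨ ·-identity u ⟩
          u                    ∎)
      ; trans = λ {u} {v} {w} (g , ug≈v) (h , vh≈w) → g G.∙ h , (begin
          u · (g G.∙ h)  ≈⟨ ·-assoc u g h ⟩
          u · g · h      ≈⟨ ·-cong ug≈v G.refl ⟩
          v · h          ≈⟨ vh≈w ⟩
          w              ∎)
      }
    }
    where open SetoidReasoning X.vertices

  private module O = Setoid orbits

  quotient : Graph
  quotient = record
    { vertices   = orbits
    ; Adj        = λ u v → ∃[ u′ ] ∃[ v′ ] u O.≈ u′ × v O.≈ v′ × X.Adj u′ v′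
    ; Adj-resp-≈ =
        (λ v≈w (u′ , v′ , u≈u′ , v≈v′ , a) →
           u′ , v′ , u≈u′ , O.trans (O.sym v≈w) v≈v′ , a)
      , (λ u≈w (u′ , v′ , u≈u′ , v≈v′ , a) →
           u′ , v′ , O.trans (O.sym u≈w) u≈u′ , v≈v′ , a)
    ; Adj-sym    = λ (u′ , v′ , u≈u′ , v≈v′ , a) → v′ , u′ , v≈v′ , u≈u′ , X.Adj-sym a
    }

record IsGaloisCover (X̃ X : FiniteSimpleGraph) (p : graph X̃ ⟶ graph X)
                     (G : Group 0ℓ 0ℓ) (α : RightAction G (graph X̃)) : Set where
  private
    module X̃ = FiniteSimpleGraph X̃
    module X = FiniteSimpleGraph X
    module G = Group G
  open RightAction α
  field
    covering       : IsCovering X̃ X p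
    preservesFiber : ∀ ṽ g → to p (ṽ · g) X.≈ to p ṽ
    free           : ∀ ṽ g → ṽ · g X̃.≈ ṽ → g G.≈ G.ε
    transitive     : ∀ ũ ṽ → to p ũ X.≈ to p ṽ → ∃[ g ] ũ · g X̃.≈ ṽ
    quotient≅      : quotient α ≅ X.graph

------------------------------------------------------------------------
-- Symmetric groups

-- Composition is that of functions, whereas _∘ₚ_ is diagrammatic.

𝔖 : ℕ → Group 0ℓ 0ℓ
𝔖 m = record
  { Carrier = Permutation′ m
  ; _≈_     = Perm._≈_
  ; _∙_     = λ ξ τ → τ ∘ₚ ξ
  ; ε       = Perm.id
  ; _⁻¹     = Perm.flip
  ; isGroup = record
    { isMonoid = record
      { isSemigroup = record
        { isMagma = record
          { isEquivalence = record
            { refl  = λ _ → refl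
            ; sym   = λ eq i → sym (eq i)
            ; trans = λ eq₁ eq₂ i → trans (eq₁ i) (eq₂ i)
            }
          ; ∙-cong = λ {ξ} ξ≈ξ′ τ≈τ′ i → trans (cong (ξ ⟨$⟩ʳ_) (τ≈τ′ i)) (ξ≈ξ′ _)
          }
        ; assoc = λ _ _ _ _ → refl
        }
      ; identity = (λ _ _ → refl) , (λ _ _ → refl)
      }
    ; inverse = (λ ξ _ → Perm.inverseˡ ξ) , (λ ξ _ → Perm.inverseʳ ξ)
    ; ⁻¹-cong = λ {ξ} {τ} ξ≈τ i → trans (sym (Perm.inverseˡ τ)) (cong (τ ⟨$⟩ˡ_)
                  (trans (sym (ξ≈τ _)) (Perm.inverseʳ ξ)))
    }
  }

private
  module 𝔖-finite where
    open Perm using (_≈_)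

    remove-cong : ∀ {m} {ξ τ : Permutation′ (suc m)} → ξ ≈ τ → remove zero ξ ≈ remove zero τ
    remove-cong {ξ = ξ} {τ} ξ≈τ k = punchIn-injective (ξ ⟨$⟩ʳ zero) _ _ (begin
      punchIn (ξ ⟨$⟩ʳ zero) (remove zero ξ ⟨$⟩ʳ k)  ≡⟨ Perm.punchIn-permute ξ zero k ⟨
      ξ ⟨$⟩ʳ suc k                                  ≡⟨ ξ≈τ (suc k) ⟩
      τ ⟨$⟩ʳ suc k                                  ≡⟨ Perm.punchIn-permute τ zero k ⟩
      punchIn (τ ⟨$⟩ʳ zero) (remove zero τ ⟨$⟩ʳ k)  ≡⟨ cong (λ i → punchIn i (remove zero τ ⟨$⟩ʳ k)) (ξ≈τ zero) ⟨
      punchIn (ξ ⟨$⟩ʳ zero) (remove zero τ ⟨$⟩ʳ k)  ∎)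
      where open ≡-Reasoning

    insert-cong : ∀ {m} {i j} {ξ τ : Permutation′ m} → i ≡ j → ξ ≈ τ →
                  insert zero i ξ ≈ insert zero j τ
    insert-cong i≡j ξ≈τ zero = i≡j
    insert-cong {i = i} {ξ = ξ} {τ} refl ξ≈τ (suc k) = begin
      insert zero i ξ ⟨$⟩ʳ suc k  ≡⟨ Perm.insert-punchIn zero i ξ k ⟩
      punchIn i (ξ ⟨$⟩ʳ k)        ≡⟨ cong (punchIn i) (ξ≈τ k) ⟩
      punchIn i (τ ⟨$⟩ʳ k)        ≡⟨ Perm.insert-punchIn zero i τ k ⟨
      insert zero i τ ⟨$⟩ʳ suc k  ∎
      where open ≡-Reasoning

    encode : ∀ m → Permutation′ m → Fin (m !)
    encode zero    ξ = zero
    encode (suc m) ξ = combine (ξ ⟨$⟩ʳ zero) (encode m (remove zero ξ))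

    decode : ∀ m → Fin (m !) → Permutation′ m
    decode zero    k = Perm.id
    decode (suc m) k =
      insert zero (proj₁ (remQuot {suc m} (m !) k)) (decode m (proj₂ (remQuot {suc m} (m !) k)))

    encode-cong : ∀ m {ξ τ : Permutation′ m} → ξ ≈ τ → encode m ξ ≡ encode m τ
    encode-cong zero    ξ≈τ = refl
    encode-cong (suc m) {ξ} {τ} ξ≈τ =
      cong₂ combine (ξ≈τ zero) (encode-cong m (remove-cong {ξ = ξ} {τ} ξ≈τ))

    encode-decode : ∀ m k → encode m (decode m k) ≡ k
    encode-decode zero    zero = refl
    encode-decode (suc m) k = begin
      combine i (encode m (remove zero (insert zero i ξ)))
        ≡⟨ cong (combine i) (encode-cong m (Perm.remove-insert zero i ξ)) ⟩
      combine i (encode m ξ)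
        ≡⟨ cong (combine i) (encode-decode m j) ⟩
      combine i j
        ≡⟨ combine-remQuot {suc m} (m !) k ⟩
      k ∎
      where
      open ≡-Reasoning
      i = proj₁ (remQuot {suc m} (m !) k)
      j = proj₂ (remQuot {suc m} (m !) k)
      ξ = decode m j

    decode-encode : ∀ m ξ → decode m (encode m ξ) ≈ ξ
    decode-encode zero    ξ ()
    decode-encode (suc m) ξ i = begin
      decode (suc m) (encode (suc m) ξ) ⟨$⟩ʳ i
        ≡⟨ cong (λ ab → insert zero (proj₁ ab) (decode m (proj₂ ab)) ⟨$⟩ʳ i)
             (remQuot-combine (ξ ⟨$⟩ʳ zero) (encode m (remove zero ξ))) ⟩
      insert zero (ξ ⟨$⟩ʳ zero) (decode m (encode m (remove zero ξ))) ⟨$⟩ʳ i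
        ≡⟨ insert-cong {ξ = decode m (encode m (remove zero ξ))} {remove zero ξ} refl
             (decode-encode m (remove zero ξ)) i ⟩
      insert zero (ξ ⟨$⟩ʳ zero) (remove zero ξ) ⟨$⟩ʳ i
        ≡⟨ Perm.insert-remove zero ξ i ⟩
      ξ ⟨$⟩ʳ i ∎
      where open ≡-Reasoning

𝔖-finite : ∀ m → IsFinite (Group.setoid (𝔖 m))
𝔖-finite m = m ! , record
  { to        = encode m
  ; from      = decode m
  ; to-cong   = encode-cong m
  ; from-cong = λ { refl _ → refl }
  ; inverse   = (λ {k} ξ≈ → trans (encode-cong m ξ≈) (encode-decode m k))
              , (λ { {ξ} refl → decode-encode m ξ })
  }
  where open 𝔖-finite

-- 𝔖ₙ as the subgroup of 𝔖ₙ₊₁ fixing the last point.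
extend : ∀ {n} → Permutation′ n → Permutation′ (suc n)
extend {n} = insert (fromℕ n) (fromℕ n)

punchIn-fromℕ : ∀ {n} (k : Fin n) → punchIn (fromℕ n) k ≡ inject₁ k
punchIn-fromℕ zero    = refl
punchIn-fromℕ (suc k) = cong suc (punchIn-fromℕ k)

extend-fromℕ : ∀ {n} (τ : Permutation′ n) → extend τ ⟨$⟩ʳ fromℕ n ≡ fromℕ n
extend-fromℕ {n} τ with fromℕ n ≟ fromℕ n
... | yes _ = refl
... | no ≢  = contradiction refl ≢

extend-inject₁ : ∀ {n} (τ : Permutation′ n) k → extend τ ⟨$⟩ʳ inject₁ k ≡ inject₁ (τ ⟨$⟩ʳ k)
extend-inject₁ {n} τ k = begin
  extend τ ⟨$⟩ʳ inject₁ k            ≡⟨ cong (extend τ ⟨$⟩ʳ_) (punchIn-fromℕ k) ⟨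
  extend τ ⟨$⟩ʳ punchIn (fromℕ n) k  ≡⟨ Perm.insert-punchIn (fromℕ n) (fromℕ n) τ k ⟩
  punchIn (fromℕ n) (τ ⟨$⟩ʳ k)       ≡⟨ punchIn-fromℕ _ ⟩
  inject₁ (τ ⟨$⟩ʳ k)                 ∎
  where open ≡-Reasoning

------------------------------------------------------------------------
-- Cayley graphs

record ConnectionSet (G : Group 0ℓ 0ℓ) : Set₁ where
  open Group G
  field
    S         : Pred Carrier 0ℓ
    S-resp-≈  : S Respects _≈_
    S-closed  : ∀ {s} → S s → S (s ⁻¹)
    S∌ε       : ¬ S ε

Cay : (G : Group 0ℓ 0ℓ) → IsFinite (Group.setoid G) → ConnectionSet G → FiniteSimpleGraph
Cay G fin conn = record
  { graph = record
    { vertices   = G.setoid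
    ; Adj        = λ ξ η → ∃[ s ] S s × η G.≈ ξ G.∙ s
    ; Adj-resp-≈ =
        (λ η≈η′ (s , s∈S , η≈ξs) → s , s∈S , G.trans (G.sym η≈η′) η≈ξs)
      , (λ ξ≈ξ′ (s , s∈S , η≈ξs) → s , s∈S , G.trans η≈ξs (G.∙-congʳ ξ≈ξ′))
    ; Adj-sym    = λ {ξ} {η} (s , s∈S , η≈ξs) → s G.⁻¹ , S-closed s∈S , (begin
        ξ                      ≈⟨ G.identityʳ ξ ⟨
        ξ G.∙ G.ε              ≈⟨ G.∙-congˡ (G.inverseʳ s) ⟨
        ξ G.∙ (s G.∙ s G.⁻¹)   ≈⟨ G.assoc ξ s (s G.⁻¹) ⟨
        ξ G.∙ s G.∙ s G.⁻¹     ≈⟨ G.∙-congʳ η≈ξs ⟨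
        η G.∙ s G.⁻¹           ∎)
    }
  ; isFiniteSimple = record
    { irreflexive = λ {ξ} {η} ξ≈η (s , s∈S , η≈ξs) → S∌ε (S-resp-≈ (begin
        s                      ≈⟨ G.identityˡ s ⟨
        G.ε G.∙ s              ≈⟨ G.∙-congʳ (G.inverseˡ ξ) ⟨
        ξ G.⁻¹ G.∙ ξ G.∙ s     ≈⟨ G.assoc (ξ G.⁻¹) ξ s ⟩
        ξ G.⁻¹ G.∙ (ξ G.∙ s)   ≈⟨ G.∙-congˡ η≈ξs ⟨
        ξ G.⁻¹ G.∙ η           ≈⟨ G.∙-congˡ ξ≈η ⟨
        ξ G.⁻¹ G.∙ ξ           ≈⟨ G.inverseˡ ξ ⟩
        G.ε                    ∎) s∈S)
    ; finite = fin
    }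
  }
  where
  module G = Group G
  open ConnectionSet conn
  open SetoidReasoning G.setoid

------------------------------------------------------------------------
-- Star graphs, with {1,…,n+1} encoded as Fin (suc n) and n+1 as fromℕ n

transpose-left : ∀ {m} (i j : Fin m) → transpose i j ⟨$⟩ʳ i ≡ j
transpose-left i j rewrite dec-true (i ≟ i) refl = refl

transpose-right : ∀ {m} (i j : Fin m) → transpose i j ⟨$⟩ʳ j ≡ i
transpose-right i j with j ≟ i
... | yes j≡i = j≡i
... | no _ rewrite dec-true (j ≟ j) refl = refl

transpose-other : ∀ {m} (i j : Fin m) {k} → k ≢ i → k ≢ j → transpose i j ⟨$⟩ʳ k ≡ k
transpose-other i j {k} k≢i k≢j
  rewrite dec-false (k ≟ i) k≢i | dec-false (k ≟ j) k≢j = refl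

transpose-comm : ∀ {m} (i j k : Fin m) → transpose i j ⟨$⟩ʳ k ≡ transpose j i ⟨$⟩ʳ k
transpose-comm i j k = go (k ≟ i) (k ≟ j)
  where
  go : Dec (k ≡ i) → Dec (k ≡ j) → transpose i j ⟨$⟩ʳ k ≡ transpose j i ⟨$⟩ʳ k
  go (yes refl) _          = trans (transpose-left k j) (sym (transpose-right j k))
  go (no _)     (yes refl) = trans (transpose-right i k) (sym (transpose-left k i))
  go (no k≢i)   (no k≢j)   = trans (transpose-other i j k≢i k≢j) (sym (transpose-other j i k≢j k≢i))

starTransposition : ∀ {n} → Fin n → Permutation′ (suc n)
starTransposition {n} i = transpose (inject₁ i) (fromℕ n)

starSet : ∀ n → ConnectionSet (𝔖 (suc n))
starSet n = record
  { S        = λ s → ∃[ i ] s ≈ starTransposition i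
  ; S-resp-≈ = λ {s} {t} s≈t (i , s≈) → i , trans′ {t} {s} {starTransposition i} (sym′ {s} {t} s≈t) s≈
  ; S-closed = λ {s} (i , s≈) → i , λ k →
      trans (⁻¹-cong {s} {starTransposition i} s≈ k) (transpose-comm (fromℕ n) (inject₁ i) k)
  ; S∌ε      = λ (i , ε≈) →
      fromℕ≢inject₁ (trans (ε≈ (fromℕ n)) (transpose-right (inject₁ i) (fromℕ n)))
  }
  where open Group (𝔖 (suc n)) using (_≈_; ⁻¹-cong) renaming (sym to sym′; trans to trans′)

starGraph : ℕ → FiniteSimpleGraph
starGraph n = Cay (𝔖 (suc n)) (𝔖-finite (suc n)) (starSet n)

complete : ℕ → FiniteSimpleGraph
complete m = record
  { graph = record
    { vertices   = setoid (Fin m)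
    ; Adj        = _≢_
    ; Adj-resp-≈ = (λ { refl a → a }) , (λ { refl a → a })
    ; Adj-sym    = λ u≢v v≡u → u≢v (sym v≡u)
    }
  ; isFiniteSimple = record
    { irreflexive = λ u≡v u≢v → u≢v u≡v
    ; finite      = m , inverse (setoid (Fin m))
    }
  }

evalLast : ∀ n → graph (starGraph n) ⟶ graph (complete (suc n))
evalLast n = record
  { to      = λ ξ → ξ ⟨$⟩ʳ fromℕ n
  ; to-cong = λ ξ≈η → ξ≈η (fromℕ n)
  ; to-Adj  = λ {ξ} {η} (s , (i , s≈) , η≈ξs) ξ4≡η4 → fromℕ≢inject₁ (
      trans (Injection.injective (↔⇒↣ ξ) (trans ξ4≡η4 (η≈ξs (fromℕ n))))
        (trans (s≈ (fromℕ n)) (transpose-right (inject₁ i) (fromℕ n))))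
  }

extend-cong : ∀ {n} {σ τ : Permutation′ n} → σ Perm.≈ τ → extend σ Perm.≈ extend τ
extend-cong {σ = σ} {τ} σ≈τ k with view k
... | ‵fromℕ     = trans (extend-fromℕ σ) (sym (extend-fromℕ τ))
... | ‵inject₁ j =
  trans (extend-inject₁ σ j) (trans (cong inject₁ (σ≈τ j)) (sym (extend-inject₁ τ j)))

extend-id : ∀ {n} → extend {n} Perm.id Perm.≈ Perm.id
extend-id k with view k
... | ‵fromℕ     = extend-fromℕ Perm.id
... | ‵inject₁ j = extend-inject₁ Perm.id j

extend-∘ : ∀ {n} (σ τ : Permutation′ n) → extend (τ ∘ₚ σ) Perm.≈ extend τ ∘ₚ extend σ
extend-∘ σ τ k with view k
... | ‵fromℕ     = trans (extend-fromℕ (τ ∘ₚ σ))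
  (sym (trans (cong (extend σ ⟨$⟩ʳ_) (extend-fromℕ τ)) (extend-fromℕ σ)))
... | ‵inject₁ j = trans (extend-inject₁ (τ ∘ₚ σ) j)
  (sym (trans (cong (extend σ ⟨$⟩ʳ_) (extend-inject₁ τ j)) (extend-inject₁ σ (τ ⟨$⟩ʳ j))))

extend-starTransposition : ∀ {n} (τ : Permutation′ n) i k →
  starTransposition i ⟨$⟩ʳ (extend τ ⟨$⟩ʳ k) ≡
  extend τ ⟨$⟩ʳ (starTransposition (τ ⟨$⟩ˡ i) ⟨$⟩ʳ k)
extend-starTransposition {n} τ i k with view k
... | ‵fromℕ = begin
  starTransposition i ⟨$⟩ʳ (extend τ ⟨$⟩ʳ fromℕ n)  ≡⟨ cong (starTransposition i ⟨$⟩ʳ_) (extend-fromℕ τ) ⟩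
  starTransposition i ⟨$⟩ʳ fromℕ n                  ≡⟨ transpose-right (inject₁ i) (fromℕ n) ⟩
  inject₁ i                                         ≡⟨ cong inject₁ (Perm.inverseʳ τ) ⟨
  inject₁ (τ ⟨$⟩ʳ (τ ⟨$⟩ˡ i))                       ≡⟨ extend-inject₁ τ (τ ⟨$⟩ˡ i) ⟨
  extend τ ⟨$⟩ʳ inject₁ (τ ⟨$⟩ˡ i)                  ≡⟨ cong (extend τ ⟨$⟩ʳ_) (transpose-right (inject₁ (τ ⟨$⟩ˡ i)) (fromℕ n)) ⟨
  extend τ ⟨$⟩ʳ (starTransposition (τ ⟨$⟩ˡ i) ⟨$⟩ʳ fromℕ n) ∎
  where open ≡-Reasoning
... | ‵inject₁ j with j ≟ τ ⟨$⟩ˡ i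
...   | yes refl = begin
  starTransposition i ⟨$⟩ʳ (extend τ ⟨$⟩ʳ inject₁ (τ ⟨$⟩ˡ i))
    ≡⟨ cong (starTransposition i ⟨$⟩ʳ_) (trans (extend-inject₁ τ _) (cong inject₁ (Perm.inverseʳ τ))) ⟩
  starTransposition i ⟨$⟩ʳ inject₁ i  ≡⟨ transpose-left (inject₁ i) (fromℕ n) ⟩
  fromℕ n                             ≡⟨ extend-fromℕ τ ⟨
  extend τ ⟨$⟩ʳ fromℕ n               ≡⟨ cong (extend τ ⟨$⟩ʳ_) (transpose-left (inject₁ (τ ⟨$⟩ˡ i)) (fromℕ n)) ⟨
  extend τ ⟨$⟩ʳ (starTransposition (τ ⟨$⟩ˡ i) ⟨$⟩ʳ inject₁ (τ ⟨$⟩ˡ i)) ∎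
  where open ≡-Reasoning
...   | no j≢ = begin
  starTransposition i ⟨$⟩ʳ (extend τ ⟨$⟩ʳ inject₁ j)
    ≡⟨ cong (starTransposition i ⟨$⟩ʳ_) (extend-inject₁ τ j) ⟩
  starTransposition i ⟨$⟩ʳ inject₁ (τ ⟨$⟩ʳ j)
    ≡⟨ transpose-other (inject₁ i) (fromℕ n)
         (λ eq → j≢ (trans (sym (Perm.inverseˡ τ)) (cong (τ ⟨$⟩ˡ_) (inject₁-injective eq))))
         (λ eq → fromℕ≢inject₁ (sym eq)) ⟩
  inject₁ (τ ⟨$⟩ʳ j)
    ≡⟨ extend-inject₁ τ j ⟨
  extend τ ⟨$⟩ʳ inject₁ j
    ≡⟨ cong (extend τ ⟨$⟩ʳ_) (transpose-other (inject₁ (τ ⟨$⟩ˡ i)) (fromℕ n)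
         (λ eq → j≢ (inject₁-injective eq))
         (λ eq → fromℕ≢inject₁ (sym eq))) ⟨
  extend τ ⟨$⟩ʳ (starTransposition (τ ⟨$⟩ˡ i) ⟨$⟩ʳ inject₁ j) ∎
  where open ≡-Reasoning

rightMultiplication : ∀ n → RightAction (𝔖 n) (graph (starGraph n))
rightMultiplication n = record
  { _·_        = λ ξ τ → ξ ∙ extend τ
  ; ·-cong     = λ {ξ} {η} {σ} {τ} ξ≈η σ≈τ →
      ∙-cong {ξ} {η} {extend σ} {extend τ} ξ≈η (extend-cong {σ = σ} {τ} σ≈τ)
  ; ·-identity = λ ξ k → cong (ξ ⟨$⟩ʳ_) (extend-id k)
  ; ·-assoc    = λ ξ σ τ k → cong (ξ ⟨$⟩ʳ_) (extend-∘ σ τ k)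
  ; ·-Adj      = λ {ξ} τ (s , (i , s≈) , η≈ξs) →
      starTransposition (τ ⟨$⟩ˡ i) , (τ ⟨$⟩ˡ i , λ _ → refl) , λ k →
        trans (η≈ξs (extend τ ⟨$⟩ʳ k)) (cong (ξ ⟨$⟩ʳ_)
          (trans (s≈ (extend τ ⟨$⟩ʳ k)) (extend-starTransposition τ i k)))
  }
  where open Group (𝔖 (suc n)) using (_∙_; ∙-cong)

X₃ K₄ : FiniteSimpleGraph
X₃ = starGraph 3
K₄ = complete 4

------------------------------------------------------------------------
-- Polyhedral graphs

-- The cube [0,1]³: its vertices are {0,1}³, and an edge joins two
-- vertices differing in exactly one coordinate.

cubeGraph : Graph
cubeGraph = record
  { vertices   = setoid (Vec Bool 3)
  ; Adj        = λ u v → ∃! _≡_ λ i → lookup u i ≢ lookup v i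
  ; Adj-resp-≈ = (λ { refl a → a }) , (λ { refl a → a })
  ; Adj-sym    = λ (i , ui≢vi , unique) →
      i , (λ eq → ui≢vi (sym eq)) , λ vj≢uj → unique (λ eq → vj≢uj (sym eq))
  }

-- Truncating the tetrahedron with vertices Fin 4 cuts each edge {i , j}
-- in two points; (i , j) is the one near i.  What is left of that edge
-- joins (i , j) to (j , i), and cutting off the corner i creates a
-- triangle on the points (i , j), j ≢ i.

truncatedTetrahedronGraph : Graph
truncatedTetrahedronGraph = record
  { vertices   = On.setoid {B = Σ[ ij ∈ Fin 4 × Fin 4 ] proj₁ ij ≢ proj₂ ij}
                   (setoid (Fin 4 × Fin 4)) proj₁
  ; Adj        = λ ((i , j) , _) ((k , l) , _) → (i ≡ l × j ≡ k) ⊎ (i ≡ k × j ≢ l)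
  ; Adj-resp-≈ = (λ { refl a → a }) , (λ { refl a → a })
  ; Adj-sym    = Sum.map (λ { (refl , refl) → refl , refl })
                         (λ { (refl , j≢l) → refl , λ l≡j → j≢l (sym l≡j) })
  }

{-# OPTIONS --safe #-}
-- An intermediate cover q : X₃ → Y of the Galois cover p : X₃ → K₄ is
-- determined up to isomorphism by the stabiliser { τ ∈ 𝔖₃ ∣ q τ = q 1 }: for
-- such τ the maps q and q ∘ (_· τ) are lifts of p through Y → K₄ that agree at
-- one vertex, hence everywhere because X₃ is connected.  Properness excludes
-- the trivial subgroup and all of 𝔖₃.  The subgroup fixing c is the stabiliser
-- of ξ ↦ (ξ(c) , ξ(4)), which covers the truncated tetrahedron; the alternating
-- group is that of ξ ↦ (sgn ξ , ξ(4)), which covers the cube (the bipartite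
-- double of K₄).
module Submission where

open import Defs
open import Algebra.Bundles using (Group)
open import Data.Bool.Base using (Bool; true; false; not; _∧_; _xor_)
import Data.Bool.Properties as Bool
open import Data.Fin.Base using (Fin; fromℕ; inject₁; punchIn; punchOut; combine; remQuot)
open import Data.Fin.Patterns using (0F; 1F; 2F; 3F)
open import Data.Fin.Permutation as Perm
  using (Permutation′; _⟨$⟩ʳ_; _⟨$⟩ˡ_; _∘ₚ_; transpose; remove)
import Data.Fin.Permutation.Transposition.List as TL
open import Data.Fin.Properties as Fin
  using (_≟_; _<?_; all?; any?; fromℕ≢inject₁; inject₁-injective)
open import Data.Fin.Relation.Unary.Top using (View; view; ‵fromℕ; ‵inject₁)
open import Data.List.Base using (List; []; _∷_; map; foldr; allFin; cartesianProduct)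
open import Data.List.Properties using (map-cong)
open import Data.List.Relation.Unary.All as All using (All; []; _∷_)
open import Data.List.Relation.Unary.Any as Any using (Any)
open import Data.Nat.Base using (ℕ; zero; suc; _!; _^_)
open import Data.Product.Base using (Σ-syntax; ∃-syntax; _×_; _,_; proj₁; proj₂)
open import Data.Sum.Base as Sum using (_⊎_; inj₁; inj₂; [_,_]′)
open import Data.Vec.Base as Vec using (Vec; []; _∷_; lookup)
open import Function.Base using (_∘_)
open import Function.Bundles using (Inverse; Injection; _⇔_; mk⇔; Equivalence)
open import Function.Definitions using (Injective; Surjective)
open import Function.Properties.Equivalence using () renaming (sym to ⇔-sym; trans to ⇔-trans)
open import Function.Properties.Inverse using (↔⇒↣)
open import Level using (0ℓ)
open import Relation.Binary.Bundles using (Setoid)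
open import Relation.Binary.Definitions using (_Respects_; Decidable)
open import Relation.Binary.PropositionalEquality
  using (_≡_; _≢_; refl; sym; trans; cong; cong₂; module ≡-Reasoning)
open import Relation.Nullary using (Dec; ¬_; yes; no; does; contradiction)
open import Relation.Nullary.Decidable
  using (map′; ¬?; _×-dec_; _→-dec_; from-yes; decidable-stable)
open import Relation.Unary using (Pred)

open FiniteSimpleGraph using (graph)
open _⟶_ using (to)

-- Covers of simple graphs, neighbour by neighbour

-- Lifting runs along neighbours, whereas a covering is defined by bijections on unordered incident
-- edges; absence of loops makes the two descriptions agree. The fibres of `q` turn out to be
-- exactly the orbits of the stabiliser, so intermediate covers with equal stabilisers have equal
-- fibres, and adjacency descends because edges lift. The vertices of `Y` form a finite setoid, so
-- membership in the stabiliser is decidable and the subgroups of 𝔖₃ can be sorted by case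
-- distinction. Permutations are equal only extensionally; finite checks therefore run over codes in
-- `Fin (m !)` and are transferred along `_≈_`.

isFinite⇒≈-dec : ∀ {S} → IsFinite S → Decidable (Setoid._≈_ S)
isFinite⇒≈-dec {S} (_ , f) u v =
  map′ (λ eq → S.trans (S.sym (f.inverseʳ refl)) (f.inverseʳ eq)) f.to-cong
       (f.to u ≟ f.to v)
  where
  module S = Setoid S
  module f = Inverse f

module _ (X : Graph) where
  open Graph X

  ≈ᴱ-sym : ∀ {e f} → _≈ᴱ_ X e f → _≈ᴱ_ X f e
  ≈ᴱ-sym (inj₁ (p , q)) = inj₁ (≈-sym p , ≈-sym q)
  ≈ᴱ-sym (inj₂ (p , q)) = inj₂ (≈-sym q , ≈-sym p)

  ≈ᴱ-trans : ∀ {e f g} → _≈ᴱ_ X e f → _≈ᴱ_ X f g → _≈ᴱ_ X e g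
  ≈ᴱ-trans (inj₁ (p , q)) (inj₁ (r , s)) = inj₁ (≈-trans p r , ≈-trans q s)
  ≈ᴱ-trans (inj₁ (p , q)) (inj₂ (r , s)) = inj₂ (≈-trans p r , ≈-trans q s)
  ≈ᴱ-trans (inj₂ (p , q)) (inj₁ (r , s)) = inj₂ (≈-trans p s , ≈-trans q r)
  ≈ᴱ-trans (inj₂ (p , q)) (inj₂ (r , s)) = inj₁ (≈-trans p s , ≈-trans q r)

  -- Since `_≈ᴱ_` forgets orientation, an edge at `v` may be replaced by one with source `v`, and
  -- edges at `v` are then compared through their other ends.
  orient : ∀ {v} (e : EdgeAt X v) →
           ∃[ w ] Σ[ a ∈ Adj v w ] _≈ᴱ_ X (proj₁ e) (edge v w a)
  orient (edge s t a , inj₁ v≈s) =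
    t , proj₂ Adj-resp-≈ (≈-sym v≈s) a , inj₁ (≈-sym v≈s , ≈-refl)
  orient (edge s t a , inj₂ v≈t) =
    s , proj₂ Adj-resp-≈ (≈-sym v≈t) (Adj-sym a) , inj₂ (≈-refl , ≈-sym v≈t)

mapEdgeAt-cong : ∀ {X Y : Graph} (f : X ⟶ Y) {v} {e e′ : EdgeAt X v} →
                 _≈ᴱ_ X (proj₁ e) (proj₁ e′) →
                 _≈ᴱ_ Y (proj₁ (mapEdgeAt f v e)) (proj₁ (mapEdgeAt f v e′))
mapEdgeAt-cong f (inj₁ (p , q)) = inj₁ (_⟶_.to-cong f p , _⟶_.to-cong f q)
mapEdgeAt-cong f (inj₂ (p , q)) = inj₂ (_⟶_.to-cong f p , _⟶_.to-cong f q)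

module _ (X Y : FiniteSimpleGraph) (f : graph X ⟶ graph Y) where
  private
    module X = FiniteSimpleGraph X
    module Y = FiniteSimpleGraph Y
    open _⟶_ f using (to-cong; to-Adj)

  -- Together with `LiftsEdges` this is the edge bijection of `IsCovering`, read on neighbours.
  LocallyInjective : Set
  LocallyInjective = ∀ {u v w} → X.Adj u v → X.Adj u w → to f v Y.≈ to f w → v X.≈ w

  LiftsEdges : Set
  LiftsEdges = ∀ {u w} → Y.Adj (to f u) w → ∃[ v ] X.Adj u v × to f v Y.≈ w

  covering⇒locallyInjective : IsCovering X Y f → LocallyInjective
  covering⇒locallyInjective c {u} {v} {w} u~v u~w fv≈fw
    with proj₁ (IsCovering.bijective c u)
           {edge u v u~v , inj₁ X.≈-refl} {edge u w u~w , inj₁ X.≈-refl}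
           (inj₁ (Y.≈-refl , fv≈fw))
  ... | inj₁ (_ , v≈w) = v≈w
  -- Matching the two edges with opposite orientations would turn one of them into a loop.
  ... | inj₂ (u≈w , _) = contradiction u~w (X.irreflexive u≈w)

  covering⇒liftsEdges : IsCovering X Y f → LiftsEdges
  covering⇒liftsEdges c {u} {w} fu~w
    with proj₂ (IsCovering.bijective c u) (edge (to f u) w fu~w , inj₁ Y.≈-refl)
  ... | e , lifts with orient X.graph e
  ...   | v , u~v , e≈uv = v , u~v , head
    where
    uv = edge u v u~v
    head : to f v Y.≈ w
    head with lifts {uv , inj₁ X.≈-refl} (≈ᴱ-sym X.graph {proj₁ e} {uv} e≈uv)
    ... | inj₁ (_ , fv≈w) = fv≈w
    ... | inj₂ (fu≈w , _) = contradiction fu~w (Y.irreflexive fu≈w)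

  locallyBijective⇒covering :
    Surjective X._≈_ Y._≈_ (to f) → LocallyInjective → LiftsEdges → IsCovering X Y f
  locallyBijective⇒covering surjective locInj lifts = record
    { surjective = surjective
    ; bijective  = λ u → (λ {e} {e′} → injectiveAt u e e′) , surjectiveAt u
    }
    where
    injectiveAt : ∀ u (e e′ : EdgeAt X.graph u) →
      _≈ᴱ_ Y.graph (proj₁ (mapEdgeAt f u e)) (proj₁ (mapEdgeAt f u e′)) →
      _≈ᴱ_ X.graph (proj₁ e) (proj₁ e′)
    injectiveAt u e e′ fe≈fe′ with orient X.graph e | orient X.graph e′
    ... | v , u~v , e≈ | w , u~w , e′≈ =
      ≈ᴱ-trans X.graph {proj₁ e} {edge u v u~v} {proj₁ e′} e≈
        (≈ᴱ-trans X.graph {edge u v u~v} {edge u w u~w} {proj₁ e′}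
          (inj₁ (X.≈-refl , locInj u~v u~w heads))
          (≈ᴱ-sym X.graph {proj₁ e′} {edge u w u~w} e′≈))
      where
      ev = edge u v u~v , inj₁ X.≈-refl
      ew = edge u w u~w , inj₁ X.≈-refl
      image : ∀ {v} → EdgeAt X.graph v → Edge Y.graph
      image {v} = proj₁ ∘ mapEdgeAt f v
      heads : to f v Y.≈ to f w
      heads with ≈ᴱ-trans Y.graph {image ev} {image e} {image ew}
                   (≈ᴱ-sym Y.graph {image e} {image ev} (mapEdgeAt-cong f {u} {e} {ev} e≈))
                   (≈ᴱ-trans Y.graph {image e} {image e′} {image ew} fe≈fe′
                     (mapEdgeAt-cong f {u} {e′} {ew} e′≈))
      ... | inj₁ (_ , fv≈fw) = fv≈fw
      ... | inj₂ (fu≈fw , _) = contradiction (to-Adj u~w) (Y.irreflexive fu≈fw)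

    surjectiveAt : ∀ u (e : EdgeAt Y.graph (to f u)) →
      ∃[ d ] (∀ {d′} → _≈ᴱ_ X.graph (proj₁ {B = Incident X.graph u} d′) (proj₁ d) →
                 _≈ᴱ_ Y.graph (proj₁ (mapEdgeAt f u d′)) (proj₁ e))
    surjectiveAt u e with orient Y.graph e
    ... | w , fu~w , e≈ with lifts fu~w
    ...   | v , u~v , fv≈w = d , λ {d′} d′≈ →
      ≈ᴱ-trans Y.graph {proj₁ (mapEdgeAt f u d′)} {proj₁ (mapEdgeAt f u d)} {proj₁ e}
        (mapEdgeAt-cong f {u} {d′} {d} d′≈)
        (≈ᴱ-trans Y.graph {proj₁ (mapEdgeAt f u d)} {edge (to f u) w fu~w} {proj₁ e}
          (inj₁ (Y.≈-refl , fv≈w))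
          (≈ᴱ-sym Y.graph {proj₁ e} {edge (to f u) w fu~w} e≈))
      where d = edge u v u~v , inj₁ X.≈-refl

  -- Adjacency is reflected because an edge from `f u` to `f v` lifts to an edge at `u` whose other
  -- end lies over `f v`, hence is `v` by injectivity.
  injectiveCovering⇒isIsomorphism :
    IsCovering X Y f → Injective X._≈_ Y._≈_ (to f) → IsIsomorphism f
  injectiveCovering⇒isIsomorphism c injective = record
    { bijective   = injective , IsCovering.surjective c
    ; reflectsAdj = λ fu~fv → let w , u~w , fw≈fv = covering⇒liftsEdges c fu~fv in
                      proj₁ X.Adj-resp-≈ (injective fw≈fv) u~w
    }

≅-refl : ∀ {X} → X ≅ X
≅-refl = record { to = λ u → u ; to-cong = λ u≈v → u≈v ; to-Adj = λ u~v → u~v }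
  , record { bijective = (λ u≈v → u≈v) , λ u → u , λ v≈u → v≈u ; reflectsAdj = λ u~v → u~v }

-- Most of the two covering conditions is inherited from `p`. Local injectivity of `q` follows from
-- `p = r ∘ q`. An edge of `Y` is pushed down by `r` and lifted through `p`, and local injectivity
-- of `r` shows that the lift lies over it. Edges lift through `r` by way of a preimage under `q`.
-- For concrete covers this leaves only surjectivity of `q` and local injectivity of `r`.
intermediateCover :
  ∀ {X̃ X : FiniteSimpleGraph} {p : graph X̃ ⟶ graph X} → IsCovering X̃ X p →
  (Y : FiniteSimpleGraph) (q : graph X̃ ⟶ graph Y) (r : graph Y ⟶ graph X) →
  (∀ ṽ → FiniteSimpleGraph._≈_ X (to p ṽ) (to r (to q ṽ))) →
  Surjective (FiniteSimpleGraph._≈_ X̃) (FiniteSimpleGraph._≈_ Y) (to q) →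
  LocallyInjective Y X r →
  IntermediateCover X̃ X p
intermediateCover {X̃} {X} {p} p-covering Y q r factors q-surjective r-locInj = record
  { Y          = Y
  ; q          = q
  ; r          = r
  ; q-covering = locallyBijective⇒covering X̃ Y q q-surjective
      (λ {u} {v} {w} u~v u~w qv≈qw → covering⇒locallyInjective X̃ X p p-covering u~v u~w
         (X.≈-trans (factors v) (X.≈-trans (r.to-cong qv≈qw) (X.≈-sym (factors w)))))
      (λ {u} {w} qu~w →
         let v , u~v , pv≈rw = covering⇒liftsEdges X̃ X p p-covering
               (proj₂ X.Adj-resp-≈ (X.≈-sym (factors u)) (r.to-Adj qu~w))
         in v , u~v , r-locInj (q.to-Adj u~v) qu~w (X.≈-trans (X.≈-sym (factors v)) pv≈rw))
  ; r-covering = locallyBijective⇒covering Y X r r-surjective r-locInj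
      (λ {u} {w} ru~w →
         let ũ , qũ≈u = section u
             v , ũ~v , pv≈w = covering⇒liftsEdges X̃ X p p-covering
               (proj₂ X.Adj-resp-≈
                 (X.≈-sym (X.≈-trans (factors ũ) (r.to-cong qũ≈u))) ru~w)
         in to q v , proj₂ Y.Adj-resp-≈ qũ≈u (q.to-Adj ũ~v)
          , X.≈-trans (X.≈-sym (factors v)) pv≈w)
  ; factors    = factors
  }
  where
  module X̃ = FiniteSimpleGraph X̃
  module X = FiniteSimpleGraph X
  module Y = FiniteSimpleGraph Y
  module q = _⟶_ q
  module r = _⟶_ r
  section : ∀ y → ∃[ ṽ ] to q ṽ Y.≈ y
  section y = proj₁ (q-surjective y) , proj₂ (q-surjective y) X̃.≈-refl
  r-surjective : Surjective Y._≈_ X._≈_ (to r)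
  r-surjective w =
    let ṽ , pṽ≈w = IsCovering.surjective p-covering w
    in to q ṽ , λ z≈qṽ → X.≈-trans (r.to-cong z≈qṽ)
                 (X.≈-trans (X.≈-sym (factors ṽ)) (pṽ≈w X̃.≈-refl))

-- Intermediate covers of a connected Galois cover

-- Connectedness as an induction principle instead of by paths: a property invariant under adjacency
-- spreads from one vertex to all. Statements about lifts are proved in just this form.
Connected : Graph → Set₁
Connected X = ∀ {P : Pred Vertex 0ℓ} → P Respects _≈_ → P Respects Adj →
              ∀ u v → P u → P v
  where open Graph X

module ConnectedGalois
  {X̃ X : FiniteSimpleGraph} {p : graph X̃ ⟶ graph X} {G : Group 0ℓ 0ℓ}
  {α : RightAction G (graph X̃)} (galois : IsGaloisCover X̃ X p G α)
  (connected : Connected (graph X̃)) (v₀ : FiniteSimpleGraph.Vertex X̃)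
  where
  private
    module X̃ = FiniteSimpleGraph X̃
    module X = FiniteSimpleGraph X
    module G = Group G
  open RightAction α
  open IsGaloisCover galois

  module Stabiliser (C : IntermediateCover X̃ X p) where
    open IntermediateCover C public
    private
      module Y = FiniteSimpleGraph Y
      module q = _⟶_ q
      module r = _⟶_ r

    -- Tested at the base vertex only; `q-·-anywhere` shows that the choice of `v₀` is immaterial.
    Stab : Pred G.Carrier 0ℓ
    Stab g = to q (v₀ · g) Y.≈ to q v₀

    Stab? : ∀ g → Dec (Stab g)
    Stab? g = isFinite⇒≈-dec Y.finite _ _

    Stab-resp-≈ : Stab Respects G._≈_
    Stab-resp-≈ g≈h g∈ = Y.≈-trans (q.to-cong (·-cong X̃.≈-refl (G.sym g≈h))) g∈

    r∘q-· : ∀ ṽ g → to r (to q (ṽ · g)) X.≈ to r (to q ṽ)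
    r∘q-· ṽ g = X.≈-trans (X.≈-sym (factors (ṽ · g)))
                  (X.≈-trans (preservesFiber ṽ g) (factors ṽ))

    -- q and q ∘ (_· g) both lift p through r, so agreement at one vertex
    -- propagates along edges.
    q-·-anywhere : ∀ {g} u v → to q (u · g) Y.≈ to q u → to q (v · g) Y.≈ to q v
    q-·-anywhere {g} = connected
      (λ u≈v eq → Y.≈-trans (q.to-cong (·-cong (X̃.≈-sym u≈v) G.refl))
                    (Y.≈-trans eq (q.to-cong u≈v)))
      (λ {u} {v} u~v eq → covering⇒locallyInjective Y X r r-covering
         (proj₂ Y.Adj-resp-≈ eq (q.to-Adj (·-Adj g u~v))) (q.to-Adj u~v) (r∘q-· v g))

    Stab-ε : Stab G.ε
    Stab-ε = q.to-cong (·-identity v₀)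

    Stab-∙ : ∀ {g h} → Stab g → Stab h → Stab (g G.∙ h)
    Stab-∙ {g} {h} g∈ h∈ = Y.≈-trans (q.to-cong (·-assoc v₀ g h))
      -- In a right action `h` acts at `v₀ · g`, so its membership is carried there from `v₀`.
      (Y.≈-trans (q-·-anywhere v₀ (v₀ · g) h∈) g∈)

    -- Points with equal image under `q` lie in one fibre of `p`, so transitivity supplies the group
    -- element. With `Stab⇒q≈` this identifies the fibres of `q` with the orbits of the stabiliser.
    q≈⇒Stab : ∀ {u v} → to q u Y.≈ to q v → ∃[ g ] Stab g × u · g X̃.≈ v
    q≈⇒Stab {u} {v} qu≈qv =
      let g , ug≈v = transitive u v (X.≈-trans (factors u)
                       (X.≈-trans (r.to-cong qu≈qv) (X.≈-sym (factors v))))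
      in g , q-·-anywhere u v₀ (Y.≈-trans (q.to-cong ug≈v) (Y.≈-sym qu≈qv)) , ug≈v

    Stab⇒q≈ : ∀ {g u v} → Stab g → u · g X̃.≈ v → to q u Y.≈ to q v
    Stab⇒q≈ {u = u} g∈ ug≈v =
      Y.≈-trans (Y.≈-sym (q-·-anywhere v₀ u g∈)) (q.to-cong ug≈v)

    trivialStab⇒q-iso : (∀ g → Stab g → g G.≈ G.ε) → IsIsomorphism q
    trivialStab⇒q-iso trivial = injectiveCovering⇒isIsomorphism X̃ Y q q-covering
      λ {u} {v} qu≈qv → let g , g∈ , ug≈v = q≈⇒Stab qu≈qv in
        X̃.≈-trans (X̃.≈-sym (·-identity u))
          (X̃.≈-trans (·-cong X̃.≈-refl (G.sym (trivial g g∈))) ug≈v)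

    q-section : ∀ y → ∃[ ṽ ] to q ṽ Y.≈ y
    q-section y = let ṽ , eq = IsCovering.surjective q-covering y in ṽ , eq X̃.≈-refl

    fullStab⇒r-iso : (∀ g → Stab g) → IsIsomorphism r
    fullStab⇒r-iso full = injectiveCovering⇒isIsomorphism Y X r r-covering
      λ {y} {z} ry≈rz →
        let u , qu≈y = q-section y
            v , qv≈z = q-section z
            g , ug≈v = transitive u v (X.≈-trans (factors u) (X.≈-trans (r.to-cong qu≈y)
                         (X.≈-trans ry≈rz (X.≈-sym (X.≈-trans (factors v) (r.to-cong qv≈z))))))
        in Y.≈-trans (Y.≈-sym qu≈y) (Y.≈-trans (Stab⇒q≈ (full g) ug≈v) qv≈z)

    q-iso⇒trivialStab : IsIsomorphism q → ∀ g → Stab g → g G.≈ G.ε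
    q-iso⇒trivialStab iso g g∈ = free v₀ g (proj₁ (IsIsomorphism.bijective iso) g∈)

    r-iso⇒fullStab : IsIsomorphism r → ∀ g → Stab g
    r-iso⇒fullStab iso g = proj₁ (IsIsomorphism.bijective iso) (r∘q-· v₀ g)

  open Stabiliser using (Stab; Stab?)

  module _ (C D : IntermediateCover X̃ X p) where
    private
      module C = Stabiliser C
      module D = Stabiliser D
      module Y = FiniteSimpleGraph C.Y
      module Z = FiniteSimpleGraph D.Y

    Stab-⊆⇒q≈ : (∀ g → Stab C g → Stab D g) →
                ∀ {u v} → to C.q u Y.≈ to C.q v → to D.q u Z.≈ to D.q v
    Stab-⊆⇒q≈ C⊆D eq = let g , g∈C , ug≈v = C.q≈⇒Stab eq in D.Stab⇒q≈ (C⊆D g g∈C) ug≈v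

  -- Equal stabilisers give `C.q` and `D.q` the same fibres, so lifting along `C.q` and projecting
  -- by `D.q` does not depend on the lift chosen. In either direction an edge is first lifted to
  -- `X̃` and then projected.
  equalStab⇒≅ : (C D : IntermediateCover X̃ X p) → (∀ g → Stab C g ⇔ Stab D g) →
                graph (IntermediateCover.Y C) ≅ graph (IntermediateCover.Y D)
  equalStab⇒≅ C D C≡D = φ , record
    { bijective   = (λ {y} {z} eq → Y.≈-trans (Y.≈-sym (proj₂ (C.q-section y)))
                       (Y.≈-trans (D⇒C eq) (proj₂ (C.q-section z))))
                  , λ z → let ṽ , Dṽ≈z = D.q-section z in to C.q ṽ , λ {y} y≈ →
                       Z.≈-trans (C⇒D (Y.≈-trans (proj₂ (C.q-section y)) y≈)) Dṽ≈z
    ; reflectsAdj = λ {y} {z} a →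
        let ũ , Cũ≈y = C.q-section y
            ṽ , Cṽ≈z = C.q-section z
            w̃ , ũ~w̃ , Dw̃≈ = covering⇒liftsEdges X̃ D.Y D.q D.q-covering a
        in proj₂ Y.Adj-resp-≈ Cũ≈y (proj₁ Y.Adj-resp-≈ (Y.≈-trans (D⇒C Dw̃≈) Cṽ≈z)
             (_⟶_.to-Adj C.q ũ~w̃))
    }
    where
    module C = Stabiliser C
    module D = Stabiliser D
    module Y = FiniteSimpleGraph C.Y
    module Z = FiniteSimpleGraph D.Y
    C⇒D : ∀ {u v} → to C.q u Y.≈ to C.q v → to D.q u Z.≈ to D.q v
    C⇒D = Stab-⊆⇒q≈ C D (λ g → Equivalence.to (C≡D g))
    D⇒C : ∀ {u v} → to D.q u Z.≈ to D.q v → to C.q u Y.≈ to C.q v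
    D⇒C = Stab-⊆⇒q≈ D C (λ g → Equivalence.from (C≡D g))
    φ : graph C.Y ⟶ graph D.Y
    φ = record
      { to      = λ y → to D.q (proj₁ (C.q-section y))
      ; to-cong = λ {y} {z} y≈z → C⇒D (Y.≈-trans (proj₂ (C.q-section y))
                    (Y.≈-trans y≈z (Y.≈-sym (proj₂ (C.q-section z)))))
      ; to-Adj  = λ {y} {z} y~z →
          let ũ , Cũ≈y = C.q-section y
              ṽ , Cṽ≈z = C.q-section z
              w̃ , ũ~w̃ , Cw̃≈ = covering⇒liftsEdges X̃ C.Y C.q C.q-covering
                (proj₂ Y.Adj-resp-≈ (Y.≈-sym Cũ≈y) y~z)
          in proj₁ Z.Adj-resp-≈ (C⇒D (Y.≈-trans Cw̃≈ (Y.≈-sym Cṽ≈z)))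
               (_⟶_.to-Adj D.q ũ~w̃)
      }

-- Star graphs

transpose-self : ∀ {m} (i : Fin m) → transpose i i Perm.≈ Perm.id
transpose-self i k = go (k ≟ i)
  where
  go : Dec (k ≡ i) → transpose i i ⟨$⟩ʳ k ≡ k
  go (yes refl) = transpose-left k k
  go (no k≢i)   = transpose-other i i k≢i k≢i

starTransposition-fromℕ : ∀ {n} (i : Fin n) → starTransposition i ⟨$⟩ʳ fromℕ n ≡ inject₁ i
starTransposition-fromℕ i = transpose-right (inject₁ i) (fromℕ _)

starTransposition-self : ∀ {n} (i : Fin n) → starTransposition i ⟨$⟩ʳ inject₁ i ≡ fromℕ n
starTransposition-self i = transpose-left (inject₁ i) (fromℕ _)

starTransposition-other : ∀ {n} {i j : Fin n} → j ≢ i →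
                          starTransposition i ⟨$⟩ʳ inject₁ j ≡ inject₁ j
starTransposition-other {n} {i} j≢i = transpose-other (inject₁ i) (fromℕ n)
  (j≢i ∘ inject₁-injective) (fromℕ≢inject₁ ∘ sym)

-- Conjugating the star transposition at `j` by the one at `i` replaces the last point by `i`. Every
-- transposition of two other points is thus a walk of length three in the star graph.
transpose-inject₁ : ∀ {n} {i j : Fin n} → i ≢ j →
  transpose (inject₁ i) (inject₁ j) Perm.≈
  starTransposition i ∘ₚ starTransposition j ∘ₚ starTransposition i
transpose-inject₁ {n} {i} {j} i≢j k = sym (go (view k))
  where
  open ≡-Reasoning
  s t : Fin (suc n) → Fin (suc n)
  s = starTransposition i ⟨$⟩ʳ_
  t = starTransposition j ⟨$⟩ʳ_
  go : ∀ {k} → View k →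
       s (t (s k)) ≡ transpose (inject₁ i) (inject₁ j) ⟨$⟩ʳ k
  go ‵fromℕ = begin
    s (t (s (fromℕ n)))  ≡⟨ cong (s ∘ t) (starTransposition-fromℕ i) ⟩
    s (t (inject₁ i))    ≡⟨ cong s (starTransposition-other i≢j) ⟩
    s (inject₁ i)        ≡⟨ starTransposition-self i ⟩
    fromℕ n            ≡⟨ transpose-other _ _ fromℕ≢inject₁ fromℕ≢inject₁ ⟨
    transpose (inject₁ i) (inject₁ j) ⟨$⟩ʳ fromℕ n  ∎
  go (‵inject₁ l) with l ≟ i | l ≟ j
  ... | yes refl | _ = begin
    s (t (s (inject₁ l)))  ≡⟨ cong (s ∘ t) (starTransposition-self l) ⟩
    s (t (fromℕ n))        ≡⟨ cong s (starTransposition-fromℕ j) ⟩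
    s (inject₁ j)          ≡⟨ starTransposition-other (i≢j ∘ sym) ⟩
    inject₁ j            ≡⟨ transpose-left (inject₁ l) (inject₁ j) ⟨
    transpose (inject₁ l) (inject₁ j) ⟨$⟩ʳ inject₁ l  ∎
  ... | no l≢i | yes refl = begin
    s (t (s (inject₁ l)))  ≡⟨ cong (s ∘ t) (starTransposition-other l≢i) ⟩
    s (t (inject₁ l))      ≡⟨ cong s (starTransposition-self l) ⟩
    s (fromℕ n)            ≡⟨ starTransposition-fromℕ i ⟩
    inject₁ i            ≡⟨ transpose-right (inject₁ i) (inject₁ l) ⟨
    transpose (inject₁ i) (inject₁ l) ⟨$⟩ʳ inject₁ l  ∎
  ... | no l≢i | no l≢j = begin
    s (t (s (inject₁ l)))  ≡⟨ cong (s ∘ t) (starTransposition-other l≢i) ⟩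
    s (t (inject₁ l))      ≡⟨ cong s (starTransposition-other l≢j) ⟩
    s (inject₁ l)          ≡⟨ starTransposition-other l≢i ⟩
    inject₁ l            ≡⟨ transpose-other _ _ (l≢i ∘ inject₁-injective) (l≢j ∘ inject₁-injective) ⟨
    transpose (inject₁ i) (inject₁ j) ⟨$⟩ʳ inject₁ l  ∎

module _ {n : ℕ} where
  open FiniteSimpleGraph (starGraph n) using (Adj)

  Adj-starTransposition : ∀ ξ i → Adj ξ (starTransposition i ∘ₚ ξ)
  Adj-starTransposition ξ i = starTransposition i , (i , λ _ → refl) , λ _ → refl

  Adj⇒starTransposition : ∀ {ξ η} → Adj ξ η → ∃[ i ] η Perm.≈ starTransposition i ∘ₚ ξ
  Adj⇒starTransposition {ξ} (s , (i , s≈) , η≈ξs) =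
    i , λ k → trans (η≈ξs k) (cong (ξ ⟨$⟩ʳ_) (s≈ k))

-- The permutation `ξ⁻¹ η` is a product of transpositions, and multiplying by each of them on the
-- right is a walk in the star graph. As `_∘ₚ_` is diagrammatic, such a factor stands on the left of
-- `∘ₚ ζ`.
starGraph-connected : ∀ n → Connected (graph (starGraph n))
starGraph-connected n {P} P-resp-≈ P-resp-Adj ξ η Pξ =
  P-resp-≈ {eval (decompose (η ∘ₚ Perm.flip ξ)) ∘ₚ ξ} {η}
    (λ k → trans (cong (ξ ⟨$⟩ʳ_) (eval-decompose (η ∘ₚ Perm.flip ξ) k)) (Perm.inverseʳ ξ))
    (P-eval (decompose (η ∘ₚ Perm.flip ξ)))
  where
  open TL using (eval; decompose; eval-decompose)
  P-star : ∀ ζ i → P ζ → P (starTransposition i ∘ₚ ζ)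
  P-star ζ i = P-resp-Adj {ζ} {starTransposition i ∘ₚ ζ} (Adj-starTransposition ζ i)
  P-resp-∘ₚ : ∀ {π ρ} ζ → π Perm.≈ ρ → P (ρ ∘ₚ ζ) → P (π ∘ₚ ζ)
  P-resp-∘ₚ {π} {ρ} ζ π≈ρ =
    P-resp-≈ {ρ ∘ₚ ζ} {π ∘ₚ ζ} λ k → cong (ζ ⟨$⟩ʳ_) (sym (π≈ρ k))
  P-transpose : ∀ ζ i j → P ζ → P (transpose i j ∘ₚ ζ)
  P-transpose ζ i j Pζ with view i | view j
  -- A list of transpositions may contain pairs with equal entries; these act as the identity.
  ... | ‵fromℕ     | ‵fromℕ     =
    P-resp-∘ₚ {transpose (fromℕ n) (fromℕ n)} {Perm.id} ζ (transpose-self (fromℕ n)) Pζ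
  ... | ‵inject₁ a | ‵fromℕ     = P-star ζ a Pζ
  ... | ‵fromℕ     | ‵inject₁ b =
    P-resp-∘ₚ {transpose (fromℕ n) (inject₁ b)} {starTransposition b} ζ
      (transpose-comm (fromℕ n) (inject₁ b)) (P-star ζ b Pζ)
  ... | ‵inject₁ a | ‵inject₁ b with a ≟ b
  ...   | yes refl =
    P-resp-∘ₚ {transpose (inject₁ a) (inject₁ a)} {Perm.id} ζ (transpose-self (inject₁ a)) Pζ
  ...   | no a≢b   =
    P-resp-∘ₚ {transpose (inject₁ a) (inject₁ b)}
      {starTransposition a ∘ₚ starTransposition b ∘ₚ starTransposition a} ζ
      (transpose-inject₁ a≢b)
      (P-star (starTransposition b ∘ₚ starTransposition a ∘ₚ ζ) a
        (P-star (starTransposition a ∘ₚ ζ) b (P-star ζ a Pζ)))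
  P-eval : ∀ ts → P (eval ts ∘ₚ ξ)
  P-eval []             = P-resp-≈ {ξ} {Perm.id ∘ₚ ξ} (λ _ → refl) Pξ
  P-eval ((i , j) ∷ ts) = P-transpose (eval ts ∘ₚ ξ) i j (P-eval ts)

-- The neighbours of `ξ` take the values `ξ (inject₁ i)` at the last point, distinct because `ξ` is
-- injective. A value `w` other than `ξ (fromℕ n)` is attained for `inject₁ i = ξ⁻¹ w`, which cannot
-- be the last point.
evalLast-covering : ∀ n → IsCovering (starGraph n) (complete (suc n)) (evalLast n)
evalLast-covering n = locallyBijective⇒covering (starGraph n) (complete (suc n)) (evalLast n)
  (λ i → transpose (fromℕ n) i , λ ξ≈ → trans (ξ≈ (fromℕ n)) (transpose-left (fromℕ n) i))
  (λ {ξ} {η} {ζ} → locInj ξ η ζ)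
  (λ {ξ} {w} ξn≢w → lift ξ w ξn≢w (view (ξ ⟨$⟩ˡ w)) refl)
  where
  open FiniteSimpleGraph (starGraph n) using (Adj)
  open ≡-Reasoning
  locInj : ∀ ξ η ζ → Adj ξ η → Adj ξ ζ → η ⟨$⟩ʳ fromℕ n ≡ ζ ⟨$⟩ʳ fromℕ n → η Perm.≈ ζ
  locInj ξ η ζ ξ~η ξ~ζ ηn≡ζn k
    with Adj⇒starTransposition {ξ = ξ} {η} ξ~η | Adj⇒starTransposition {ξ = ξ} {ζ} ξ~ζ
  ... | i , η≈ξsᵢ | j , ζ≈ξsⱼ = begin
    η ⟨$⟩ʳ k                             ≡⟨ η≈ξsᵢ k ⟩
    ξ ⟨$⟩ʳ (starTransposition i ⟨$⟩ʳ k)  ≡⟨ cong (λ l → ξ ⟨$⟩ʳ (starTransposition l ⟨$⟩ʳ k)) i≡j ⟩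
    ξ ⟨$⟩ʳ (starTransposition j ⟨$⟩ʳ k)  ≡⟨ ζ≈ξsⱼ k ⟨
    ζ ⟨$⟩ʳ k                             ∎
    where
    at-n : ∀ {θ l} → θ Perm.≈ starTransposition l ∘ₚ ξ → θ ⟨$⟩ʳ fromℕ n ≡ ξ ⟨$⟩ʳ inject₁ l
    at-n {l = l} θ≈ = trans (θ≈ (fromℕ n)) (cong (ξ ⟨$⟩ʳ_) (starTransposition-fromℕ l))
    i≡j : i ≡ j
    i≡j = inject₁-injective (Injection.injective (↔⇒↣ ξ)
      (trans (sym (at-n {η} η≈ξsᵢ)) (trans ηn≡ζn (at-n {ζ} ζ≈ξsⱼ))))
  lift : ∀ ξ w → ξ ⟨$⟩ʳ fromℕ n ≢ w → ∀ {k} → View k → ξ ⟨$⟩ˡ w ≡ k →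
         ∃[ η ] Adj ξ η × η ⟨$⟩ʳ fromℕ n ≡ w
  lift ξ w ξn≢w ‵fromℕ eq =
    contradiction (trans (cong (ξ ⟨$⟩ʳ_) (sym eq)) (Perm.inverseʳ ξ)) ξn≢w
  lift ξ w ξn≢w (‵inject₁ i) eq =
    starTransposition i ∘ₚ ξ , Adj-starTransposition ξ i , (begin
      ξ ⟨$⟩ʳ (starTransposition i ⟨$⟩ʳ fromℕ n)  ≡⟨ cong (ξ ⟨$⟩ʳ_) (starTransposition-fromℕ i) ⟩
      ξ ⟨$⟩ʳ inject₁ i                           ≡⟨ cong (ξ ⟨$⟩ʳ_) eq ⟨
      ξ ⟨$⟩ʳ (ξ ⟨$⟩ˡ w)                          ≡⟨ Perm.inverseʳ ξ ⟩
      w                                          ∎)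

extend-remove : ∀ {n} (π : Permutation′ (suc n)) → π ⟨$⟩ʳ fromℕ n ≡ fromℕ n →
                extend (remove (fromℕ n) π) Perm.≈ π
extend-remove {n} π πn≡n k = begin
  extend (remove (fromℕ n) π) ⟨$⟩ʳ k
    ≡⟨ cong (λ i → Perm.insert (fromℕ n) i (remove (fromℕ n) π) ⟨$⟩ʳ k) πn≡n ⟨
  Perm.insert (fromℕ n) (π ⟨$⟩ʳ fromℕ n) (remove (fromℕ n) π) ⟨$⟩ʳ k
    ≡⟨ Perm.insert-remove (fromℕ n) π k ⟩
  π ⟨$⟩ʳ k ∎
  where open ≡-Reasoning

starGraph-isGaloisCover : ∀ n →
  IsGaloisCover (starGraph n) (complete (suc n)) (evalLast n) (𝔖 n) (rightMultiplication n)
starGraph-isGaloisCover n = record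
  { covering       = evalLast-covering n
  ; preservesFiber = λ ξ τ → cong (ξ ⟨$⟩ʳ_) (extend-fromℕ τ)
  ; free           = λ ξ τ ξτ≈ξ k → inject₁-injective (trans (sym (extend-inject₁ τ k))
                       (Injection.injective (↔⇒↣ ξ) (ξτ≈ξ (inject₁ k))))
  ; transitive     = transitive
  ; quotient≅      = record
    { to      = λ ξ → ξ ⟨$⟩ʳ fromℕ n
    ; to-cong = λ {ξ} {η} → orbit⇒fiber ξ η
    ; to-Adj  = λ {ξ} {η} (ξ′ , η′ , ξ≈ξ′ , η≈η′ , ξ′~η′) ξn≡ηn →
        _⟶_.to-Adj (evalLast n) {ξ′} {η′} ξ′~η′
          (trans (sym (orbit⇒fiber ξ ξ′ ξ≈ξ′)) (trans ξn≡ηn (orbit⇒fiber η η′ η≈η′)))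
    } , record
    { bijective   = (λ {ξ} {η} → transitive ξ η)
                  , λ i → transpose (fromℕ n) i , λ {ξ} ξ≈ →
                      trans (orbit⇒fiber ξ (transpose (fromℕ n) i) ξ≈) (transpose-left (fromℕ n) i)
    ; reflectsAdj = λ {ξ} {η} ξn≢ηn →
        let ζ , ξ~ζ , ζn≡ηn = covering⇒liftsEdges (starGraph n) (complete (suc n)) (evalLast n)
                                (evalLast-covering n) {ξ} ξn≢ηn
        in ξ , ζ , (Perm.id , λ k → cong (ξ ⟨$⟩ʳ_) (extend-id k))
         , transitive η ζ (sym ζn≡ηn) , ξ~ζ
    }
  }
  where
  open RightAction (rightMultiplication n) using (_·_)
  orbit⇒fiber : ∀ ξ η → ∃[ τ ] ξ · τ Perm.≈ η → ξ ⟨$⟩ʳ fromℕ n ≡ η ⟨$⟩ʳ fromℕ n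
  orbit⇒fiber ξ η (τ , ξτ≈η) =
    trans (cong (ξ ⟨$⟩ʳ_) (sym (extend-fromℕ τ))) (ξτ≈η (fromℕ n))
  transitive : ∀ ξ η → ξ ⟨$⟩ʳ fromℕ n ≡ η ⟨$⟩ʳ fromℕ n → ∃[ τ ] ξ · τ Perm.≈ η
  -- If `ξ` and `η` agree at the last point then `ξ⁻¹ η` fixes it, and hence is the extension of its
  -- restriction.
  transitive ξ η ξn≡ηn = remove (fromℕ n) ξ⁻¹η , λ k →
    trans (cong (ξ ⟨$⟩ʳ_) (extend-remove ξ⁻¹η
            (trans (cong (ξ ⟨$⟩ˡ_) (sym ξn≡ηn)) (Perm.inverseˡ ξ)) k))
          (Perm.inverseʳ ξ)
    where ξ⁻¹η = η ∘ₚ Perm.flip ξ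

-- An enumeration of 𝔖ₘ, surjective up to `_≈_`, over which decidable statements are settled by
-- exhaustive search.
permutation : ∀ m → Fin (m !) → Permutation′ m
permutation m = Inverse.from (proj₂ (𝔖-finite m))

permutation-surjective : ∀ {m} (ξ : Permutation′ m) → ∃[ k ] permutation m k Perm.≈ ξ
permutation-surjective {m} ξ =
  Inverse.to (proj₂ (𝔖-finite m)) ξ , Inverse.inverseʳ (proj₂ (𝔖-finite m)) {ξ} refl

-- The truncated tetrahedron and the cube

truncatedTetrahedron : FiniteSimpleGraph
truncatedTetrahedron = record
  { graph          = truncatedTetrahedronGraph
  ; isFiniteSimple = record
    { irreflexive = λ { {_ , i≢j} refl (inj₁ (i≡j , _)) → i≢j i≡j
                      ; {_} refl (inj₂ (_ , j≢j)) → j≢j refl }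
    ; finite      = 12 , record
      { to        = λ ((i , j) , i≢j) → combine i (punchOut i≢j)
      -- The count is 4 · 3: `j` is recorded by its position among the three points other than `i`.
      ; from      = λ k → let i , j = remQuot {4} 3 k in
                      (i , punchIn i j) , (λ eq → Fin.punchInᵢ≢i i j (sym eq))
      ; to-cong   = λ { {(i , _) , _} refl → cong (combine i) (Fin.punchOut-cong i refl) }
      ; from-cong = λ { refl → refl }
      ; inverse   = (λ {k} eq → trans (to-from k _ eq) (Fin.combine-remQuot {4} 3 k))
                  , λ { {u} refl → from-to u }
      }
    }
  }
  where
  to-from : ∀ k (u : Σ[ ij ∈ Fin 4 × Fin 4 ] proj₁ ij ≢ proj₂ ij) →
            let i , j = remQuot {4} 3 k in
            proj₁ u ≡ (i , punchIn i j) →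
            combine (proj₁ (proj₁ u)) (punchOut (proj₂ u)) ≡ combine i j
  to-from k ((i , _) , i≢) refl =
    cong (combine i) (trans (Fin.punchOut-cong i refl) (Fin.punchOut-punchIn i))
  from-to : ∀ (u : Σ[ ij ∈ Fin 4 × Fin 4 ] proj₁ ij ≢ proj₂ ij) →
            let i , j = remQuot {4} 3 (combine (proj₁ (proj₁ u)) (punchOut (proj₂ u)))
            in (i , punchIn i j) ≡ proj₁ u
  from-to ((i , j) , i≢j) = trans
    (cong (λ (a , b) → a , punchIn a b) (Fin.remQuot-combine i (punchOut i≢j)))
    (cong (i ,_) (Fin.punchIn-punchOut i≢j))

truncatedTetrahedronCover : Fin 3 → IntermediateCover X₃ K₄ (evalLast 3)
truncatedTetrahedronCover c = intermediateCover (evalLast-covering 3) truncatedTetrahedron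
  (record
    { to      = λ ξ → (ξ ⟨$⟩ʳ inject₁ c , ξ ⟨$⟩ʳ 3F) , distinct ξ
    ; to-cong = λ ξ≈η → cong₂ _,_ (ξ≈η (inject₁ c)) (ξ≈η 3F)
    ; to-Adj  = λ {ξ} {η} → q-Adj ξ η
    })
  (record
    { to      = λ ((_ , j) , _) → j
    ; to-cong = cong proj₂
    ; to-Adj  = λ { {_ , i≢j} (inj₁ (refl , refl)) eq → i≢j (sym eq)
                  ; (inj₂ (_ , j≢l)) → j≢l }
    })
  (λ _ → refl)
  (λ ((i , j) , i≢j) → preimage i j i≢j)
  -- The neighbours of `(i , j)` are `(j , i)` and the two `(i , l)` with `l` outside `{i , j}`, so
  -- their second entries are pairwise distinct.
  (λ { (inj₁ (refl , refl)) (inj₁ (refl , refl)) _ → refl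
     ; {w = _ , k≢l} (inj₁ (refl , _)) (inj₂ (refl , _)) eq → contradiction eq k≢l
     ; {v = _ , k≢l} (inj₂ (refl , _)) (inj₁ (refl , _)) eq → contradiction (sym eq) k≢l
     ; (inj₂ (refl , _)) (inj₂ (refl , _)) refl → refl })
  where
  open ≡-Reasoning
  open FiniteSimpleGraph X₃ using (Adj)
  distinct : ∀ (ξ : Permutation′ 4) → ξ ⟨$⟩ʳ inject₁ c ≢ ξ ⟨$⟩ʳ 3F
  distinct ξ eq = fromℕ≢inject₁ (sym (Injection.injective (↔⇒↣ ξ) eq))
  q-Adj : ∀ ξ η → Adj ξ η →
          Graph.Adj truncatedTetrahedronGraph
            ((ξ ⟨$⟩ʳ inject₁ c , ξ ⟨$⟩ʳ 3F) , distinct ξ)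
            ((η ⟨$⟩ʳ inject₁ c , η ⟨$⟩ʳ 3F) , distinct η)
  q-Adj ξ η ξ~η with Adj⇒starTransposition {ξ = ξ} {η} ξ~η
  -- The star transposition at `c` swaps the two entries, giving an edge left from the tetrahedron;
  -- any other keeps the first entry, giving an edge of a corner triangle.
  ... | i , η≈ξs with c ≟ i
  ...   | yes refl = inj₁
    ( sym (trans (η≈ξs 3F) (cong (ξ ⟨$⟩ʳ_) (starTransposition-fromℕ c)))
    , sym (trans (η≈ξs (inject₁ c)) (cong (ξ ⟨$⟩ʳ_) (starTransposition-self c))))
  ...   | no c≢i   = inj₂
    ( sym (trans (η≈ξs (inject₁ c)) (cong (ξ ⟨$⟩ʳ_) (starTransposition-other c≢i)))
    , to-Adj {ξ} {η} ξ~η)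
    where open _⟶_ (evalLast 3) using (to-Adj)
  preimage : ∀ i j → i ≢ j → ∃[ ξ ] (∀ {η} → η Perm.≈ ξ →
             (η ⟨$⟩ʳ inject₁ c , η ⟨$⟩ʳ 3F) ≡ (i , j))
  -- Here `π` sends the last point to `j`, and the preceding transposition sends `c` to `π⁻¹ i`. It
  -- leaves the last point alone because `i ≢ j`.
  preimage i j i≢j = transpose (inject₁ c) c′ ∘ₚ π , λ η≈ξ → cong₂ _,_
    (begin
      _                                                ≡⟨ η≈ξ (inject₁ c) ⟩
      π ⟨$⟩ʳ (transpose (inject₁ c) c′ ⟨$⟩ʳ inject₁ c)
        ≡⟨ cong (π ⟨$⟩ʳ_) (transpose-left (inject₁ c) c′) ⟩
      π ⟨$⟩ʳ c′                                        ≡⟨ Perm.inverseʳ π ⟩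
      i                                                ∎)
    (begin
      _                                        ≡⟨ η≈ξ 3F ⟩
      π ⟨$⟩ʳ (transpose (inject₁ c) c′ ⟨$⟩ʳ 3F)
        ≡⟨ cong (π ⟨$⟩ʳ_) (transpose-other (inject₁ c) c′ fromℕ≢inject₁ 3≢c′) ⟩
      π ⟨$⟩ʳ 3F                                ≡⟨ transpose-left 3F j ⟩
      j                                        ∎)
    where
    π = transpose 3F j
    c′ = π ⟨$⟩ˡ i
    3≢c′ : 3F ≢ c′
    3≢c′ eq = i≢j (begin
      i          ≡⟨ Perm.inverseʳ π ⟨
      π ⟨$⟩ʳ c′  ≡⟨ cong (π ⟨$⟩ʳ_) eq ⟨
      π ⟨$⟩ʳ 3F  ≡⟨ transpose-left 3F j ⟩
      j          ∎)

bits : ∀ n → Vec Bool n → Fin (2 ^ n)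
bits zero    []      = 0F
bits (suc n) (b ∷ u) = combine (Inverse.from Fin.2↔Bool b) (bits n u)

unbits : ∀ n → Fin (2 ^ n) → Vec Bool n
unbits zero    _ = []
unbits (suc n) k = let b , u = remQuot {2} (2 ^ n) k in Inverse.to Fin.2↔Bool b ∷ unbits n u

bits-unbits : ∀ n k → bits n (unbits n k) ≡ k
bits-unbits zero    0F = refl
bits-unbits (suc n) k = let b , u = remQuot {2} (2 ^ n) k in
  trans (cong₂ combine (Inverse.strictlyInverseʳ Fin.2↔Bool b) (bits-unbits n u))
        (Fin.combine-remQuot {2} (2 ^ n) k)

unbits-bits : ∀ n u → unbits n (bits n u) ≡ u
unbits-bits zero    []      = refl
unbits-bits (suc n) (b ∷ u) = trans
  (cong (λ (x , y) → Inverse.to Fin.2↔Bool x ∷ unbits n y)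
        (Fin.remQuot-combine (Inverse.from Fin.2↔Bool b) (bits n u)))
  (cong₂ _∷_ (Inverse.strictlyInverseˡ Fin.2↔Bool b) (unbits-bits n u))

cube : FiniteSimpleGraph
cube = record
  { graph          = cubeGraph
  ; isFiniteSimple = record
    { irreflexive = λ { refl (_ , uᵢ≢uᵢ , _) → uᵢ≢uᵢ refl }
    ; finite      = 8 , record
      { to        = bits 3
      ; from      = unbits 3
      ; to-cong   = cong (bits 3)
      ; from-cong = cong (unbits 3)
      ; inverse   = (λ { {k} refl → bits-unbits 3 k }) , λ { {u} refl → unbits-bits 3 u }
      }
    }
  }

open Graph cubeGraph using () renaming (Adj to CubeAdj)

cubeAdj? : ∀ u v → Dec (CubeAdj u v)
cubeAdj? u v = map′ (λ (i , p , uniq) → i , p , λ {j} → uniq j)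
                    (λ (i , p , uniq) → i , p , λ j → uniq {j})
  (any? λ i → differ? i ×-dec all? λ j → differ? j →-dec (i ≟ j))
  where
  differ? : ∀ i → Dec (lookup u i ≢ lookup v i)
  differ? i = ¬? (lookup u i Bool.≟ lookup v i)

-- The number of inversions modulo two, so `true` means odd.
parity : ∀ {m} → Permutation′ m → Bool
parity {m} ξ = foldr _xor_ false
  (map (λ (i , j) → does (i <? j) ∧ does (ξ ⟨$⟩ʳ j <? ξ ⟨$⟩ʳ i))
       (cartesianProduct (allFin m) (allFin m)))

parity-cong : ∀ {m} {ξ η : Permutation′ m} → ξ Perm.≈ η → parity ξ ≡ parity η
parity-cong {m} ξ≈η = cong (foldr _xor_ false)
  (map-cong (λ (i , j) → cong₂ (λ a b → does (i <? j) ∧ does (a <? b)) (ξ≈η j) (ξ≈η i))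
            (cartesianProduct (allFin m) (allFin m)))

-- A tetrahedron inscribed in the cube: its corners carry the even
-- permutations and their antipodes the odd ones, so that the cover of K₄
-- identifies antipodal vertices.
corner : Fin 4 → Vec Bool 3
corner 0F = false ∷ true  ∷ true  ∷ []
corner 1F = true  ∷ false ∷ true  ∷ []
corner 2F = true  ∷ true  ∷ false ∷ []
corner 3F = false ∷ false ∷ false ∷ []

cubeVertex : Bool → Fin 4 → Vec Bool 3
cubeVertex b i = Vec.map (b xor_) (corner i)

diagonal : Vec Bool 3 → Fin 4
diagonal (true  ∷ false ∷ false ∷ []) = 0F
diagonal (false ∷ true  ∷ true  ∷ []) = 0F
diagonal (false ∷ true  ∷ false ∷ []) = 1F
diagonal (true  ∷ false ∷ true  ∷ []) = 1F
diagonal (false ∷ false ∷ true  ∷ []) = 2F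
diagonal (true  ∷ true  ∷ false ∷ []) = 2F
diagonal (false ∷ false ∷ false ∷ []) = 3F
diagonal (true  ∷ true  ∷ true  ∷ []) = 3F

-- This makes `X₃` bipartite, so that the sign can serve as a coordinate on a cover. The 24 codes
-- and three transpositions are checked exhaustively.
parity-starTransposition : ∀ (ξ : Permutation′ 4) i →
  parity (starTransposition i ∘ₚ ξ) ≡ not (parity ξ)
parity-starTransposition ξ i = let k , k≈ξ = permutation-surjective ξ in begin
  parity (starTransposition i ∘ₚ ξ)
    ≡⟨ parity-cong {ξ = starTransposition i ∘ₚ permutation 4 k} {starTransposition i ∘ₚ ξ}
         (λ j → k≈ξ _) ⟨
  parity (starTransposition i ∘ₚ permutation 4 k)
    ≡⟨ enumerated k i ⟩
  not (parity (permutation 4 k))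
    ≡⟨ cong not (parity-cong {ξ = permutation 4 k} {ξ} k≈ξ) ⟩
  not (parity ξ) ∎
  where
  open ≡-Reasoning
  enumerated : ∀ k i →
    parity (starTransposition i ∘ₚ permutation 4 k) ≡ not (parity (permutation 4 k))
  enumerated = from-yes (all? λ k → all? λ i →
    parity (starTransposition i ∘ₚ permutation 4 k) Bool.≟ not (parity (permutation 4 k)))

∀-Bool? : ∀ {P : Pred Bool 0ℓ} → (∀ b → Dec (P b)) → Dec (∀ b → P b)
∀-Bool? P? = map′ (λ { (f , t) false → f ; (f , t) true → t }) (λ p → p false , p true)
  (P? false ×-dec P? true)

-- Two corners of the inscribed tetrahedron differ in two coordinates, so a corner and the antipode
-- of another differ in exactly one, while a corner and its own antipode differ in all three.
cubeVertex-Adj : ∀ b c i j → c ≡ not b × i ≢ j → CubeAdj (cubeVertex b i) (cubeVertex c j)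
cubeVertex-Adj = from-yes (∀-Bool? λ b → ∀-Bool? λ c → all? λ i → all? λ j →
  (c Bool.≟ not b ×-dec ¬? (i ≟ j)) →-dec cubeAdj? (cubeVertex b i) (cubeVertex c j))

cubeVertex-Adj⁻¹ : ∀ b c i j → CubeAdj (cubeVertex b i) (cubeVertex c j) → c ≡ not b × i ≢ j
cubeVertex-Adj⁻¹ = from-yes (∀-Bool? λ b → ∀-Bool? λ c → all? λ i → all? λ j →
  cubeAdj? (cubeVertex b i) (cubeVertex c j) →-dec (c Bool.≟ not b ×-dec ¬? (i ≟ j)))

diagonal-cubeVertex : ∀ b i → i ≡ diagonal (cubeVertex b i)
diagonal-cubeVertex = from-yes (∀-Bool? λ b → all? λ i → i ≟ diagonal (cubeVertex b i))

cubeVertex-surjective : ∀ u → ∃[ b ] ∃[ i ] cubeVertex b i ≡ u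
cubeVertex-surjective (true  ∷ false ∷ false ∷ []) = true  , 0F , refl
cubeVertex-surjective (false ∷ true  ∷ true  ∷ []) = false , 0F , refl
cubeVertex-surjective (false ∷ true  ∷ false ∷ []) = true  , 1F , refl
cubeVertex-surjective (true  ∷ false ∷ true  ∷ []) = false , 1F , refl
cubeVertex-surjective (false ∷ false ∷ true  ∷ []) = true  , 2F , refl
cubeVertex-surjective (true  ∷ true  ∷ false ∷ []) = false , 2F , refl
cubeVertex-surjective (true  ∷ true  ∷ true  ∷ []) = true  , 3F , refl
cubeVertex-surjective (false ∷ false ∷ false ∷ []) = false , 3F , refl

parity×evalLast-surjective : ∀ b i →
  ∃[ k ] parity (permutation 4 k) ≡ b × permutation 4 k ⟨$⟩ʳ 3F ≡ i
parity×evalLast-surjective = from-yes (∀-Bool? λ b → all? λ i → any? λ k →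
  parity (permutation 4 k) Bool.≟ b ×-dec (permutation 4 k ⟨$⟩ʳ 3F) ≟ i)

cubeCover : IntermediateCover X₃ K₄ (evalLast 3)
cubeCover = intermediateCover (evalLast-covering 3) cube
  (record
    { to      = λ ξ → cubeVertex (parity ξ) (ξ ⟨$⟩ʳ 3F)
    ; to-cong = λ {ξ} {η} ξ≈η → cong₂ cubeVertex (parity-cong {ξ = ξ} {η} ξ≈η) (ξ≈η 3F)
    ; to-Adj  = λ {ξ} {η} ξ~η → let i , η≈ξs = Adj⇒starTransposition {ξ = ξ} {η} ξ~η in
        cubeVertex-Adj (parity ξ) (parity η) (ξ ⟨$⟩ʳ 3F) (η ⟨$⟩ʳ 3F)
          ( trans (parity-cong {ξ = η} {starTransposition i ∘ₚ ξ} η≈ξs)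
              (parity-starTransposition ξ i)
          , _⟶_.to-Adj (evalLast 3) {ξ} {η} ξ~η)
    })
  (record
    { to      = diagonal
    ; to-cong = cong diagonal
    ; to-Adj  = λ {u} {v} → r-Adj u v
    })
  (λ ξ → diagonal-cubeVertex (parity ξ) (ξ ⟨$⟩ʳ 3F))
  (λ u → let b , i , bi≡u = cubeVertex-surjective u
             k , parity≡b , last≡i = parity×evalLast-surjective b i
         in permutation 4 k , λ {ξ} ξ≈ → trans
              (cong₂ cubeVertex (trans (parity-cong {ξ = ξ} {permutation 4 k} ξ≈) parity≡b)
                                (trans (ξ≈ 3F) last≡i))
              bi≡u)
  (λ {u} {v} {w} → r-locInj u v w)
  where
  r-Adj : ∀ u v → CubeAdj u v → diagonal u ≢ diagonal v
  r-Adj u v u~v eq with cubeVertex-surjective u | cubeVertex-surjective v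
  ... | b , i , refl | c , j , refl = proj₂ (cubeVertex-Adj⁻¹ b c i j u~v)
    (trans (diagonal-cubeVertex b i) (trans eq (sym (diagonal-cubeVertex c j))))
  r-locInj : ∀ u v w → CubeAdj u v → CubeAdj u w → diagonal v ≡ diagonal w → v ≡ w
  r-locInj u v w u~v u~w eq
    with cubeVertex-surjective u | cubeVertex-surjective v | cubeVertex-surjective w
  -- Both neighbours of `u` have the opposite sign, so the diagonal alone tells them apart.
  ... | b , i , refl | c , j , refl | d , k , refl = cong₂ cubeVertex
    (trans (proj₁ (cubeVertex-Adj⁻¹ b c i j u~v)) (sym (proj₁ (cubeVertex-Adj⁻¹ b d i k u~w))))
    (trans (diagonal-cubeVertex c j) (trans eq (sym (diagonal-cubeVertex d k))))

-- Subgroups of 𝔖₃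

infix 4 _≈?_
_≈?_ : ∀ {m} (π ρ : Permutation′ m) → Dec (π Perm.≈ ρ)
π ≈? ρ = all? λ i → π ⟨$⟩ʳ i ≟ ρ ⟨$⟩ʳ i

open Group (𝔖 3) using (_∙_; ε)

transpositionFixing : Fin 3 → Permutation′ 3
transpositionFixing c = transpose (punchIn c 0F) (punchIn c 1F)

-- Positive words suffice, since inverses in a finite group are powers. The list is asymmetric: it
-- contains `σ ∙ σ` but not `τ ∙ τ`, so a possible element of order three has to be put first.
shortWords : Permutation′ 3 → Permutation′ 3 → List (Permutation′ 3)
shortWords σ τ = ε ∷ σ ∷ τ ∷ σ ∙ σ ∷ σ ∙ τ ∷ τ ∙ σ ∷ σ ∙ τ ∙ σ ∷ []

infix 4 _∈⟨_,_⟩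
_∈⟨_,_⟩ : Permutation′ 3 → Permutation′ 3 → Permutation′ 3 → Set
ρ ∈⟨ σ , τ ⟩ = Any (Perm._≈ ρ) (shortWords σ τ)

∈⟨,⟩? : ∀ ρ σ τ → Dec (ρ ∈⟨ σ , τ ⟩)
∈⟨,⟩? ρ σ τ = Any.any? (_≈? ρ) (shortWords σ τ)

private
  s : Fin 6 → Permutation′ 3
  s = permutation 3

-- The stabiliser of `c` has prime index three, so adjoining any element that moves `c` yields the
-- whole group.
pointStabiliser-maximal : ∀ c k → s k ⟨$⟩ʳ c ≢ c → ∀ l → s l ∈⟨ s k , transpositionFixing c ⟩
pointStabiliser-maximal = from-yes (all? λ c → all? λ k → ¬? (s k ⟨$⟩ʳ c ≟ c) →-dec
  all? λ l → ∈⟨,⟩? (s l) (s k) (transpositionFixing c))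

pointStabiliser-generated : ∀ c k → s k ⟨$⟩ʳ c ≡ c → s k ∈⟨ ε , transpositionFixing c ⟩
pointStabiliser-generated = from-yes (all? λ c → all? λ k →
  (s k ⟨$⟩ʳ c ≟ c) →-dec ∈⟨,⟩? (s k) ε (transpositionFixing c))

odd⇒transposition : ∀ k → parity (s k) ≡ true → ∃[ c ] s k Perm.≈ transpositionFixing c
odd⇒transposition = from-yes (all? λ k →
  parity (s k) Bool.≟ true →-dec any? λ c → s k ≈? transpositionFixing c)

-- The alternating group is cyclic of order three, so `ε`, `σ` and `σ ∙ σ` already exhaust it.
even-generated : ∀ k l → ¬ s k Perm.≈ ε → parity (s k) ≡ false → parity (s l) ≡ false →
                 s l ∈⟨ s k , ε ⟩
even-generated = from-yes (all? λ k → all? λ l → ¬? (s k ≈? ε) →-dec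
  (parity (s k) Bool.≟ false →-dec (parity (s l) Bool.≟ false →-dec ∈⟨,⟩? (s l) (s k) ε)))

module _ {H : Pred (Permutation′ 3) 0ℓ} (H? : ∀ τ → Dec (H τ)) (H-resp-≈ : H Respects Perm._≈_)
         (H-ε : H ε) (H-∙ : ∀ {σ τ} → H σ → H τ → H (σ ∙ τ)) where

  H-∈⟨,⟩ : ∀ {ρ σ τ} → ρ ∈⟨ σ , τ ⟩ → H σ → H τ → H ρ
  H-∈⟨,⟩ {ρ} {σ} {τ} ρ∈ Hσ Hτ = All.lookupWith (λ {π} Hπ π≈ρ → H-resp-≈ {π} {ρ} π≈ρ Hπ) words ρ∈
    where
    words : All H (shortWords σ τ)
    words = H-ε ∷ Hσ ∷ Hτ ∷ H-∙ Hσ Hσ ∷ H-∙ Hσ Hτ ∷ H-∙ Hτ Hσ ∷ H-∙ (H-∙ Hσ Hτ) Hσ ∷ []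

  -- The split is on transpositions. If `H` contains one, it contains the stabiliser of its fixed
  -- point `c`, and a member moving `c` forces everything. If it contains none, all members are
  -- even, and a single nonidentity member generates the alternating group.
  subgroups-𝔖₃ : (∀ k → H (s k) → s k Perm.≈ ε) ⊎ (∀ k → H (s k))
               ⊎ (∃[ c ] ∀ k → H (s k) ⇔ s k ⟨$⟩ʳ c ≡ c)
               ⊎ (∀ k → H (s k) ⇔ parity (s k) ≡ false)
  subgroups-𝔖₃ = byTransposition (any? λ c → H? (transpositionFixing c))
    where
    byMover : ∀ c → H (transpositionFixing c) → Dec (∃[ k ] H (s k) × s k ⟨$⟩ʳ c ≢ c) →
              (∀ k → H (s k)) ⊎ (∀ k → H (s k) ⇔ s k ⟨$⟩ʳ c ≡ c)
    byMover c Ht (yes (k , Hk , moves)) =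
      inj₁ λ l → H-∈⟨,⟩ (pointStabiliser-maximal c k moves l) Hk Ht
    byMover c Ht (no none) = inj₂ λ k → mk⇔
      (λ Hk → decidable-stable (s k ⟨$⟩ʳ c ≟ c) λ moves → none (k , Hk , moves))
      (λ fixes → H-∈⟨,⟩ (pointStabiliser-generated c k fixes) H-ε Ht)

    byNonidentity : ¬ (∃[ c ] H (transpositionFixing c)) → Dec (∃[ k ] H (s k) × ¬ s k Perm.≈ ε) →
                    (∀ k → H (s k) → s k Perm.≈ ε) ⊎ (∀ k → H (s k) ⇔ parity (s k) ≡ false)
    byNonidentity noTransposition (no none) =
      inj₁ λ k Hk → decidable-stable (s k ≈? ε) λ k≉ε → none (k , Hk , k≉ε)
    byNonidentity noTransposition (yes (k , Hk , k≉ε)) = inj₂ λ l → mk⇔ (even l)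
      λ l-even → H-∈⟨,⟩ (even-generated k l k≉ε (even k Hk) l-even) Hk H-ε
      where
      even : ∀ l → H (s l) → parity (s l) ≡ false
      even l Hl = Bool.¬-not λ l-odd → let c , l≈t = odd⇒transposition l l-odd in
        noTransposition (c , H-resp-≈ {s l} {transpositionFixing c} l≈t Hl)

    byTransposition : Dec (∃[ c ] H (transpositionFixing c)) → _
    byTransposition (yes (c , Ht)) =
      inj₂ (Sum.map₂ (λ fixing → inj₁ (c , fixing))
        (byMover c Ht (any? λ k → H? (s k) ×-dec ¬? (s k ⟨$⟩ʳ c ≟ c))))
    byTransposition (no noTransposition) =
      Sum.map₂ (inj₂ ∘ inj₂)
        (byNonidentity noTransposition (any? λ k → H? (s k) ×-dec ¬? (s k ≈? ε)))

-- Classification and realisation of the proper intermediate covers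

module Cover = ConnectedGalois (starGraph-isGaloisCover 3) (starGraph-connected 3) Perm.id
open Cover using (module Stabiliser; equalStab⇒≅)
open Stabiliser using (Stab; Stab?)

Stab-⇔ : ∀ C D → (∀ k → Stab C (s k) ⇔ Stab D (s k)) → ∀ τ → Stab C τ ⇔ Stab D τ
Stab-⇔ C D C⇔D τ = mk⇔
  (λ τ∈C → Stabiliser.Stab-resp-≈ D {s k} {τ} k≈τ (Equivalence.to (C⇔D k)
     (Stabiliser.Stab-resp-≈ C {τ} {s k} (sym ∘ k≈τ) τ∈C)))
  (λ τ∈D → Stabiliser.Stab-resp-≈ C {s k} {τ} k≈τ (Equivalence.from (C⇔D k)
     (Stabiliser.Stab-resp-≈ D {τ} {s k} (sym ∘ k≈τ) τ∈D)))
  where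
  k = proj₁ (permutation-surjective τ)
  k≈τ = proj₂ (permutation-surjective τ)

Stab-truncatedTetrahedron : ∀ c τ → Stab (truncatedTetrahedronCover c) τ ⇔ τ ⟨$⟩ʳ c ≡ c
Stab-truncatedTetrahedron c τ = mk⇔
  (λ τ∈ → inject₁-injective (trans (sym (extend-inject₁ τ c)) (cong proj₁ τ∈)))
  (λ τc≡c → cong₂ _,_ (trans (extend-inject₁ τ c) (cong inject₁ τc≡c)) (extend-fromℕ τ))

-- Extending a permutation by a fixed largest point creates no inversion, so the parity seen in 𝔖₄
-- is that of 𝔖₃.
Stab-cube : ∀ k → Stab cubeCover (s k) ⇔ parity (s k) ≡ false
Stab-cube k = mk⇔ (stab⇒even k) (even⇒stab k)
  where
  stab⇒even : ∀ k → Stab cubeCover (s k) → parity (s k) ≡ false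
  stab⇒even = from-yes (all? λ k → Stab? cubeCover (s k) →-dec parity (s k) Bool.≟ false)
  even⇒stab : ∀ k → parity (s k) ≡ false → Stab cubeCover (s k)
  even⇒stab = from-yes (all? λ k → parity (s k) Bool.≟ false →-dec Stab? cubeCover (s k))

proper⇒cube⊎truncatedTetrahedron :
  (C : IntermediateCover X₃ K₄ (evalLast 3)) → IntermediateCover.Proper C →
  (graph (IntermediateCover.Y C) ≅ cubeGraph)
  ⊎ (graph (IntermediateCover.Y C) ≅ truncatedTetrahedronGraph)
proper⇒cube⊎truncatedTetrahedron C (q≇ , r≇) =
  [ trivial , [ full , [ fixing , even ]′ ]′ ]′
    (subgroups-𝔖₃ C.Stab? (λ {σ} {τ} → C.Stab-resp-≈ {σ} {τ}) C.Stab-ε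
      (λ {σ} {τ} → C.Stab-∙ {σ} {τ}))
  where
  module C = Stabiliser C
  Polyhedral : Set
  Polyhedral = (graph C.Y ≅ cubeGraph) ⊎ (graph C.Y ≅ truncatedTetrahedronGraph)
  trivial : (∀ k → Stab C (s k) → s k Perm.≈ ε) → Polyhedral
  trivial ≈ε = contradiction (C.trivialStab⇒q-iso λ τ τ∈ →
    let k , k≈τ = permutation-surjective τ in λ i → trans (sym (k≈τ i))
      (≈ε k (C.Stab-resp-≈ {τ} {s k} (sym ∘ k≈τ) τ∈) i)) q≇
  full : (∀ k → Stab C (s k)) → Polyhedral
  full all = contradiction (C.fullStab⇒r-iso λ τ →
    let k , k≈τ = permutation-surjective τ in C.Stab-resp-≈ {s k} {τ} k≈τ (all k)) r≇
  fixing : (∃[ c ] ∀ k → Stab C (s k) ⇔ s k ⟨$⟩ʳ c ≡ c) → Polyhedral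
  fixing (c , fixing-c) = inj₂ (equalStab⇒≅ C D (Stab-⇔ C D λ k →
      ⇔-trans (fixing-c k) (⇔-sym (Stab-truncatedTetrahedron c (s k)))))
    where D = truncatedTetrahedronCover c
  even : (∀ k → Stab C (s k) ⇔ parity (s k) ≡ false) → Polyhedral
  even ⇔even = inj₁ (equalStab⇒≅ C cubeCover (Stab-⇔ C cubeCover λ k →
      ⇔-trans (⇔even k) (⇔-sym (Stab-cube k))))

properCover : ∀ C {σ τ} → Stab C σ → ¬ σ Perm.≈ ε → ¬ Stab C τ → IntermediateCover.Proper C
properCover C {σ} {τ} σ∈ σ≉ε τ∉ =
    (λ q≅ → σ≉ε (Stabiliser.q-iso⇒trivialStab C q≅ σ σ∈))
  , (λ r≅ → τ∉ (Stabiliser.r-iso⇒fullStab C r≅ τ))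

theorem5 : IsGaloisCover X₃ K₄ (evalLast 3) (𝔖 3) (rightMultiplication 3)
    × ((C : IntermediateCover X₃ K₄ (evalLast 3)) → IntermediateCover.Proper C →
    (FiniteSimpleGraph.graph (IntermediateCover.Y C) ≅ cubeGraph)
    ⊎ (FiniteSimpleGraph.graph (IntermediateCover.Y C) ≅ truncatedTetrahedronGraph))
    × (Σ[ C ∈ IntermediateCover X₃ K₄ (evalLast 3) ]
    IntermediateCover.Proper C
    × (FiniteSimpleGraph.graph (IntermediateCover.Y C) ≅ cubeGraph))
    × (Σ[ C ∈ IntermediateCover X₃ K₄ (evalLast 3) ]
    IntermediateCover.Proper C
    × (FiniteSimpleGraph.graph (IntermediateCover.Y C) ≅ truncatedTetrahedronGraph))
theorem5 = starGraph-isGaloisCover 3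
  , proper⇒cube⊎truncatedTetrahedron
  , ( cubeCover
    -- A product of two transpositions is a nontrivial even element, here a three-cycle; a single
    -- transposition is odd and lies outside the stabiliser.
    , properCover cubeCover {transposition ∙ transpose 1F 2F} {transposition}
        refl (λ ≈ε → contradiction (≈ε 0F) λ ()) (λ ())
    , ≅-refl)
  , ( truncatedTetrahedronCover 2F
    -- The transposition of `0F` and `1F` fixes `2F`, that of `1F` and `2F` moves it.
    , properCover (truncatedTetrahedronCover 2F) {transposition} {transpose 1F 2F}
        refl (λ ≈ε → contradiction (≈ε 0F) λ ()) (λ ())
    , ≅-refl)
  where
  transposition : Permutation′ 3
  transposition = transpose 0F 1F
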